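{- There is an $O(m)$ time algorithm that can check whether, in a given directed graph with $m$ edges, there is a node $c$ such that for every other node $v$, $c$ can reach $v$ or $c$ can be reached from $v$. Consequently, there is a factor $n$ approximation for Min-Radius in linear time, where $n$ is the number of nodes of the graph.
   Context: For a directed graph $G=(V,E)$ let $d(u\to v)$ be the shortest path distance from $u$ to $v$ ($\infty$ if $v$ is not reachable from $u$). The Min-eccentricity of a node $c$ is $\max_{v\in V}\min\{d(c\to v),d(v\to c)\}$, and the Min-Radius $R$ of $G$ is the minimum Min-eccentricity over all nodes. A factor $\alpha$ approximation algorithm outputs a value $R^*$ with $R\le R^*\le \alpha R$. -}

module Defs where

open import Data.Bool.Base using (Bool; true; false)
open import Data.Fin.Base as Fin using (Fin; zero; suc; toℕ)
import Data.Fin.Properties as Fin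
open import Data.List.Base as List using (List; []; _∷_; allFin)
import Data.List.Extrema as Extrema
open import Data.List.Membership.Propositional using (_∈_)
import Data.List.Membership.DecPropositional as DecMembership
open import Data.List.Relation.Unary.Unique.Propositional using (Unique)
open import Data.Nat.Base using (ℕ; zero; suc; pred; _+_; _*_; _∸_; _≤_; _<_; _<ᵇ_; _≡ᵇ_; s≤s; z≤n)
import Data.Nat.Properties as ℕ
open import Data.Nat.Induction using (<-rec)
open import Data.Product.Base using (∃; ∃-syntax; _×_; _,_; proj₁; proj₂)
open import Data.Product.Properties using (≡-dec)
open import Data.Sum.Base using (_⊎_; inj₁; inj₂)
open import Function.Base using (_∘_)
open import Level using (0ℓ)
open import Relation.Binary.Bundles using (TotalOrder)
open import Relation.Binary.Core using (Rel)
import Relation.Binary.Construct.Add.Supremum.NonStrict as AddSup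
open import Relation.Binary.Construct.Closure.ReflexiveTransitive using (Star; ε; _◅_; _◅◅_)
open import Relation.Binary.PropositionalEquality
open import Relation.Nullary using (¬_; Dec; yes; no)
open import Relation.Nullary.Construct.Add.Supremum public using (_⁺; ⊤⁺; [_])
open import Relation.Nullary.Decidable using (map′; _×-dec_)
import Algebra.Construct.NaturalChoice.Min as NaturalMin

------------------------------------------------------------------------
-- Naturals extended by ∞ = ⊤⁺

ℕ∞ : Set
ℕ∞ = ℕ ⁺

open AddSup _≤_ public using (_≤⁺_; [_]; _≤⊤⁺)

≤∞-totalOrder : TotalOrder 0ℓ 0ℓ 0ℓ
≤∞-totalOrder = record
  { isTotalOrder = AddSup.≤⁺-isTotalOrder-≡ _≤_ ℕ.≤-isTotalOrder }

open NaturalMin ≤∞-totalOrder public using () renaming (_⊓_ to _⊓∞_)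

min∞ max∞ : List ℕ∞ → ℕ∞
min∞ = Extrema.min ≤∞-totalOrder ⊤⁺
max∞ = Extrema.max ≤∞-totalOrder [ 0 ]

-- α · ∞ = ∞ also for α = 0.
_·_ : ℕ → ℕ∞ → ℕ∞
α · [ k ] = [ α * k ]
α · ⊤⁺    = ⊤⁺

-- d is the least natural number satisfying P, or ∞ if there is none.
IsLeast : (ℕ → Set) → ℕ∞ → Set
IsLeast P [ d ] = P d × (∀ k → P k → d ≤ k)
IsLeast P ⊤⁺    = ∀ k → ¬ P k

------------------------------------------------------------------------
-- Directed graphs on the node set Fin n

record Digraph (n : ℕ) : Set where
  field
    edges  : List (Fin n × Fin n)
    unique : Unique edges

  #edges : ℕ
  #edges = List.length edges

  Edge : Rel (Fin n) 0ℓ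
  Edge u v = (u , v) ∈ edges

  Reaches : Rel (Fin n) 0ℓ
  Reaches = Star Edge

open Digraph public

length : ∀ {A : Set} {R : Rel A 0ℓ} {x y} → Star R x y → ℕ
length ε       = 0
length (_ ◅ p) = suc (length p)

module _ {n : ℕ} (G : Digraph n) where

  IsDistance : Fin n → Fin n → ℕ∞ → Set
  IsDistance u v = IsLeast (λ k → ∃[ p ] length {R = Edge G} {u} {v} p ≡ k)

  private
    Walk : Fin n → Fin n → ℕ → Set
    Walk u v k = ∃[ p ] length {R = Edge G} {u} {v} p ≡ k

    edge? : ∀ u v → Dec (Edge G u v)
    edge? u v = (u , v) ∈? edges G
      where open DecMembership (≡-dec Fin._≟_ Fin._≟_)

    walk? : ∀ u v k → Dec (Walk u v k)
    walk? u v zero = map′ (λ { refl → ε , refl }) (λ { (ε , _) → refl }) (u Fin.≟ v)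
    walk? u v (suc k) = map′
      (λ { (w , e , p , eq) → e ◅ p , cong suc eq })
      (λ { (_◅_ {j = w} e p , eq) → w , e , p , ℕ.suc-injective eq })
      (Fin.any? (λ w → edge? u w ×-dec walk? w v k))

    node : ∀ {u v} (p : Star (Edge G) u v) → Fin (suc (length p)) → Fin n
    node {u} p       zero    = u
    node     (_ ◅ p) (suc i) = node p i

    prefix : ∀ {u v} (p : Star (Edge G) u v) i → Walk u (node p i) (toℕ i)
    prefix p       zero    = ε , refl
    prefix (e ◅ p) (suc i) with q , eq ← prefix p i = e ◅ q , cong suc eq

    suffix : ∀ {u v} (p : Star (Edge G) u v) i → Walk (node p i) v (length p ∸ toℕ i)
    suffix p       zero    = p , refl
    suffix (e ◅ p) (suc i) = suffix p i

    length-◅◅ : ∀ {u v w} (p : Star (Edge G) u v) (q : Star (Edge G) v w) →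
                length (p ◅◅ q) ≡ length p + length q
    length-◅◅ ε       q = refl
    length-◅◅ (_ ◅ p) q = cong suc (length-◅◅ p q)

    shorten : ∀ {u v} k → n ≤ k → Walk u v k → ∃[ j ] (j < k × Walk u v j)
    shorten {u} {v} _ n≤k (p , refl)
      with i , j , i<j , eq ← Fin.pigeonhole (s≤s n≤k) (node p)
      with q , q-len ← subst (λ x → Walk u x (toℕ i)) eq (prefix p i)
         | r , r-len ← suffix p j
      = _ , short , q ◅◅ r , trans (length-◅◅ q r) (cong (length q +_) r-len)
      where
      short : length q + (length p ∸ toℕ j) < length p
      short rewrite q-len = ℕ.<-≤-trans (ℕ.+-monoˡ-< (length p ∸ toℕ j) i<j)
                (ℕ.≤-reflexive (ℕ.m+[n∸m]≡n (Fin.toℕ≤pred[n] j)))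

    walk<n : ∀ {u v} k → Walk u v k → ∃[ j ] (j < n × Walk u v j)
    walk<n {u} {v} = <-rec _ step
      where
      step : ∀ k → (∀ {j} → j < k → Walk u v j → ∃[ i ] (i < n × Walk u v i)) →
             Walk u v k → ∃[ i ] (i < n × Walk u v i)
      step k rec p with k ℕ.<? n
      ... | yes k<n = k , k<n , p
      ... | no  k≮n with j , j<k , q ← shorten k (ℕ.≮⇒≥ k≮n) p = rec j<k q

    search : ∀ u v b → (∃[ d ] IsDistance u v [ d ]) ⊎ (∀ k → k < b → ¬ Walk u v k)
    search u v zero = inj₂ (λ _ ())
    search u v (suc b) with search u v b
    ... | inj₁ found = inj₁ found
    ... | inj₂ none with walk? u v b
    ...   | yes p = inj₁ (b , p , λ k q → ℕ.≮⇒≥ (λ k<b → none k k<b q))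
    ...   | no ¬p = inj₂ none′
      where
      none′ : ∀ k → k < suc b → ¬ Walk u v k
      none′ k k<1+b q with ℕ.m≤n⇒m<n∨m≡n (ℕ.≤-pred k<1+b)
      ... | inj₁ k<b  = none k k<b q
      ... | inj₂ refl = ¬p q

  distance : ∀ u v → ∃ (IsDistance u v)
  distance u v with search u v n
  ... | inj₁ (d , is) = [ d ] , is
  ... | inj₂ none     = ⊤⁺ , λ k p → let j , j<n , q = walk<n k p in none j j<n q

  dist : Fin n → Fin n → ℕ∞
  dist u v = proj₁ (distance u v)

  minEccentricity : Fin n → ℕ∞
  minEccentricity c = max∞ (List.map (λ v → dist c v ⊓∞ dist v c) (allFin n))

  minRadius : ℕ∞
  minRadius = min∞ (List.map minEccentricity (allFin n))

  HasCentre : Set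
  HasCentre = ∃[ c ] (∀ v → v ≢ c → Reaches G c v ⊎ Reaches G v c)

IsApproximation : ℕ → ℕ∞ → ℕ∞ → Set
IsApproximation α R R* = R ≤⁺ R* × R* ≤⁺ (α · R)

------------------------------------------------------------------------
-- Model of computation: structured programs for a unit-cost random
-- access machine with finitely many registers and arrays, both of
-- which hold natural numbers.  The only arithmetic is successor and
-- predecessor, so in t steps no number grows by more than t beyond the
-- input and the constants of the program; in linear time all words
-- therefore have O(log (n + m)) bits, and unit cost hides no work.
-- Each instruction takes O(1) time on a word RAM with a single memory
-- (interleave the arrays), so a time bound here is one there as well.

Register Array : Set
Register = ℕ
Array    = ℕ

data Expr : Set where
  const    : ℕ → Expr
  reg      : Register → Expr
  inc dec  : Register → Expr
  _at_     : Array → Register → Expr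

data Test : Set where
  _≐_ _≺_ : Register → Register → Test

infix  6 _at_
infix  5 _:=_ _at_←_
infixr 4 _︔_

data Program : Set where
  skip          : Program
  _:=_          : Register → Expr → Program
  _at_←_        : Array → Register → Register → Program
  _︔_           : Program → Program → Program
  if_then_else_ : Test → Program → Program → Program
  while_loop_   : Test → Program → Program

record State : Set where
  constructor ⟪_,_⟫
  field
    regs   : Register → ℕ
    arrays : Array → ℕ → ℕ

open State public

_[_↦_] : ∀ {A : Set} → (ℕ → A) → ℕ → A → (ℕ → A)
(f [ i ↦ a ]) j with j ≡ᵇ i
... | true  = a
... | false = f j

eval : Expr → State → ℕ
eval (const k) s = k
eval (reg x)   s = regs s x
eval (inc x)   s = suc (regs s x)
eval (dec x)   s = pred (regs s x)
eval (a at x)  s = arrays s a (regs s x)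

test : Test → State → Bool
test (x ≐ y) s = regs s x ≡ᵇ regs s y
test (x ≺ y) s = regs s x <ᵇ regs s y

setReg : Register → ℕ → State → State
setReg x k ⟪ ρ , α ⟫ = ⟪ ρ [ x ↦ k ] , α ⟫

setArray : Array → ℕ → ℕ → State → State
setArray a i k ⟪ ρ , α ⟫ = ⟪ ρ , α [ a ↦ α a [ i ↦ k ] ] ⟫

-- ⟨ p , s ⟩⇓ s′ ∣ t : started in s, p halts in s′ after t steps.
infix 3 ⟨_,_⟩⇓_∣_

data ⟨_,_⟩⇓_∣_ : Program → State → State → ℕ → Set where
  ⇓skip   : ∀ {s} → ⟨ skip , s ⟩⇓ s ∣ 1
  ⇓assign : ∀ {s x e} → ⟨ x := e , s ⟩⇓ setReg x (eval e s) s ∣ 1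
  ⇓store  : ∀ {s a x y} →
            ⟨ a at x ← y , s ⟩⇓ setArray a (regs s x) (regs s y) s ∣ 1
  ⇓seq    : ∀ {s s′ s″ p q t t′} →
            ⟨ p , s ⟩⇓ s′ ∣ t → ⟨ q , s′ ⟩⇓ s″ ∣ t′ →
            ⟨ p ︔ q , s ⟩⇓ s″ ∣ t + t′
  ⇓then   : ∀ {s s′ b p q t} → test b s ≡ true → ⟨ p , s ⟩⇓ s′ ∣ t →
            ⟨ if b then p else q , s ⟩⇓ s′ ∣ suc t
  ⇓else   : ∀ {s s′ b p q t} → test b s ≡ false → ⟨ q , s ⟩⇓ s′ ∣ t →
            ⟨ if b then p else q , s ⟩⇓ s′ ∣ suc t
  ⇓loop   : ∀ {s s′ s″ b p t t′} → test b s ≡ true → ⟨ p , s ⟩⇓ s′ ∣ t →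
            ⟨ while b loop p , s′ ⟩⇓ s″ ∣ t′ →
            ⟨ while b loop p , s ⟩⇓ s″ ∣ suc (t + t′)
  ⇓exit   : ∀ {s b p} → test b s ≡ false → ⟨ while b loop p , s ⟩⇓ s ∣ 1

⇓-deterministic : ∀ {p s s₁ s₂ t₁ t₂} → ⟨ p , s ⟩⇓ s₁ ∣ t₁ → ⟨ p , s ⟩⇓ s₂ ∣ t₂ →
                  s₁ ≡ s₂ × t₁ ≡ t₂
⇓-deterministic ⇓skip   ⇓skip   = refl , refl
⇓-deterministic ⇓assign ⇓assign = refl , refl
⇓-deterministic ⇓store  ⇓store  = refl , refl
⇓-deterministic (⇓seq d e) (⇓seq d′ e′)
  with refl , refl ← ⇓-deterministic d d′
  with refl , refl ← ⇓-deterministic e e′ = refl , refl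
⇓-deterministic (⇓then _ d) (⇓then _ d′)
  with refl , refl ← ⇓-deterministic d d′ = refl , refl
⇓-deterministic (⇓else _ d) (⇓else _ d′)
  with refl , refl ← ⇓-deterministic d d′ = refl , refl
⇓-deterministic (⇓loop _ d e) (⇓loop _ d′ e′)
  with refl , refl ← ⇓-deterministic d d′
  with refl , refl ← ⇓-deterministic e e′ = refl , refl
⇓-deterministic (⇓exit _) (⇓exit _) = refl , refl
⇓-deterministic (⇓then b _)   (⇓else b′ _)   with () ← trans (sym b) b′
⇓-deterministic (⇓else b _)   (⇓then b′ _)   with () ← trans (sym b) b′
⇓-deterministic (⇓loop b _ _) (⇓exit b′)     with () ← trans (sym b) b′
⇓-deterministic (⇓exit b)     (⇓loop b′ _ _) with () ← trans (sym b) b′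

------------------------------------------------------------------------
-- Algorithms on digraphs

fromList : List ℕ → (ℕ → ℕ)
fromList []       _       = 0
fromList (k ∷ ks) zero    = k
fromList (k ∷ ks) (suc i) = fromList ks i

-- Registers 0 and 1 hold n and m, and arrays 0 and 1 hold the tails and the
-- heads of the m edges, in arbitrary order.  All other cells hold 0.
input : ∀ {n} → Digraph n → State
input {n} G =
  ⟪ fromList (n ∷ #edges G ∷ [])
  , (λ where
      0 → fromList (List.map (toℕ ∘ proj₁) (edges G))
      1 → fromList (List.map (toℕ ∘ proj₂) (edges G))
      _ → λ _ → 0)
  ⟫

output : State → ℕ
output s = regs s 0

-- The bound reads C * (m + 1) because even m = 0 takes a positive number
-- of steps.
SolvesInLinearTime : Program → (∀ {n} → Digraph n → ℕ → Set) → Set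
SolvesInLinearTime p Spec =
  ∃[ C ] (∀ {n} (G : Digraph n) →
    ∃[ s ] ∃[ t ] (⟨ p , input G ⟩⇓ s ∣ t × t ≤ C * suc (#edges G) × Spec G (output s)))

Decides : (∀ {n} → Digraph n → Set) → (∀ {n} → Digraph n → ℕ → Set)
Decides P G k = (k ≡ 1 × P G) ⊎ (k ≡ 0 × ¬ P G)

-- An output in ℕ∞ is coded by 0 for ∞ and by suc k for k.
decode : ℕ → ℕ∞
decode zero    = ⊤⁺
decode (suc k) = [ k ]

ApproximatesMinRadius : (∀ {n} → Digraph n → ℕ) → (∀ {n} → Digraph n → ℕ → Set)
ApproximatesMinRadius α G k = IsApproximation (α G) (minRadius G) (decode k)

#nodes : ∀ {n} → Digraph n → ℕ
#nodes {n} _ = n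

{-# OPTIONS --safe #-}
module Submission where

-- Number the strongly connected components 1, …, k in a topological order, by Kosaraju's
-- algorithm.  The nodes of component i are centres iff every component j < i has an edge into
-- some component in (j, i] and every component j > i has one from some component in [i, j):
-- following such edges, all earlier components reach i and i reaches all later ones.  So i is
-- tested against the maximum, over j < i, of the first component entered from j, and the
-- minimum, over j > i, of the last component from which j is entered.  If n > m + 1 there is
-- no centre.  If there is one and n ≥ 2, then 1 ≤ R ≤ n − 1, so that n approximates R.

open import Defs hiding (unique)
open import Algebra.Construct.NaturalChoice.Min ≤∞-totalOrder using () renaming (⊓-sel to ⊓∞-sel; ⊓-glb to ⊓∞-glb; x⊓y≤x to ⊓∞-≤ˡ; x⊓y≤y to ⊓∞-≤ʳ)
open import Data.Bool.Base using (true; false)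
open import Data.Bool.Properties using (T-≡)
open import Data.Empty using (⊥)
open import Data.Fin.Base using (Fin; zero; suc; toℕ; fromℕ<)
import Data.Fin.Properties as Fin
open import Data.List.Base as List using (List; []; _∷_; _++_; allFin)
open import Data.List.Extrema ≤∞-totalOrder using (max≤v⁺; xs≤max; v≤min⁺; min≤xs; argmin-sel)
open import Data.List.Membership.Propositional using (_∈_)
open import Data.List.Membership.Propositional.Properties using (∈-++⁺ˡ; ∈-++⁺ʳ; ∈-++⁻; ∈-map⁺; ∈-map⁻; ∈-allFin; ∈-lookup)
open import Data.List.Properties using (++-assoc; ++-identityʳ; ∷-injective)
open import Data.List.Relation.Binary.Permutation.Propositional using (_↭_; ↭-sym; ↭⇒↭ₛ)
import Data.List.Relation.Binary.Permutation.Propositional.Properties as ↭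
import Data.List.Relation.Binary.Permutation.Setoid.Properties as Permutation
open import Data.List.Relation.Unary.All as All using (All; []; _∷_)
import Data.List.Relation.Unary.All.Properties as All
open import Data.List.Relation.Unary.AllPairs using (AllPairs; []; _∷_)
open import Data.List.Relation.Unary.Any as Any using (here; there)
open import Data.List.Relation.Unary.Any.Properties using (lookup-index)
open import Data.List.Relation.Unary.Unique.Propositional using (Unique)
open import Data.Nat.Base using (ℕ; zero; suc; pred; _+_; _*_; _≤_; _<_; _<ᵇ_; _≡ᵇ_; z≤n; s≤s)
open import Data.Nat.Properties hiding (⊓-sel; ⊓-glb)
open import Data.Nat.Tactic.RingSolver using (solve-∀)
open import Data.Product.Base using (∃-syntax; _×_; _,_; proj₁; proj₂)
open import Data.Sum.Base using (_⊎_; inj₁; inj₂; swap)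
open import Data.Unit.Base using (⊤; tt)
open import Function.Base using (_∘_; case_of_; id)
open import Function.Bundles using (Equivalence)
open import Relation.Binary.Bundles using (TotalOrder)
open import Relation.Binary.Construct.Closure.ReflexiveTransitive using (Star; ε; _◅_; _◅◅_; gmap; reverse)
open import Relation.Binary.PropositionalEquality
open import Relation.Nullary using (¬_; Dec; contradiction; yes; no)
open TotalOrder ≤∞-totalOrder using () renaming (trans to ≤∞-trans; refl to ≤∞-refl)

-- The machine only counts up and down, so no offsets can be computed: the edges of a node form a
-- linked list, and every loop is flat, with a numeric variant, so that a single rule covers them
-- all. In particular the recursion of depth-first search becomes one loop over an explicit stack,
-- paid for by a potential.
--
-- Discovery and finishing times never appear. The search invariant states only what the second
-- search consumes: for a path from u to w, some node in the component of u finishes no earlier than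
-- w. This can be proved by induction along the search because the open nodes lie on one path: if a
-- node about to finish reaches a node open below it, the two are strongly connected.
--
-- The bound n ≤ m + 1 turns costs proportional to n into O(m). It holds for a graph with a centre c
-- because every other node can be charged an edge of its own, the last one on a path from c or else
-- the first one on a path to c.

≡ᵇ-true : ∀ {i j} → (i ≡ᵇ j) ≡ true → i ≡ j
≡ᵇ-true eq = ≡ᵇ⇒≡ _ _ (Equivalence.from T-≡ eq)

≡ᵇ-false : ∀ {i j} → (i ≡ᵇ j) ≡ false → i ≢ j
≡ᵇ-false {i} {j} eq i≡j with () ← trans (sym eq) (Equivalence.to T-≡ (≡⇒≡ᵇ i j i≡j))

<ᵇ-true : ∀ {i j} → (i <ᵇ j) ≡ true → i < j
<ᵇ-true eq = <ᵇ⇒< _ _ (Equivalence.from T-≡ eq)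

<ᵇ-false : ∀ {i j} → (i <ᵇ j) ≡ false → j ≤ i
<ᵇ-false eq = ≮⇒≥ λ i<j → contradiction (trans (sym eq) (Equivalence.to T-≡ (<⇒<ᵇ i<j))) λ ()

module _ {A : Set} (f : ℕ → A) where

  update-same : ∀ {i a} j → j ≡ i → (f [ i ↦ a ]) j ≡ a
  update-same {i} j j≡i with j ≡ᵇ i in eq
  ... | true  = refl
  ... | false = contradiction j≡i (≡ᵇ-false eq)

  update-other : ∀ {i a} j → j ≢ i → (f [ i ↦ a ]) j ≡ f j
  update-other {i} j j≢i with j ≡ᵇ i in eq
  ... | true  = contradiction (≡ᵇ-true eq) j≢i
  ... | false = refl

-- Running programs within a time bound

Runs : ℕ → Program → State → (State → Set) → Set
Runs T p s Q = ∃[ s′ ] ∃[ t ] (⟨ p , s ⟩⇓ s′ ∣ t × t ≤ T × Q s′)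

runs-seq : ∀ {T T′ p q s P Q} → Runs T p s P → (∀ s′ → P s′ → Runs T′ q s′ Q) →
           Runs (T + T′) (p ︔ q) s Q
runs-seq (s′ , t , d , t≤ , x) f with s″ , t′ , d′ , t′≤ , y ← f s′ x =
  s″ , _ , ⇓seq d d′ , +-mono-≤ t≤ t′≤ , y

runs-weaken : ∀ {T T′ p s P Q} → T ≤ T′ → (∀ s′ → P s′ → Q s′) → Runs T p s P → Runs T′ p s Q
runs-weaken T≤T′ f (s′ , t , d , t≤ , x) = s′ , t , d , ≤-trans t≤ T≤T′ , f s′ x

-- Meaningful for loop-free programs only: no loop satisfies WP, and the cost of one is junk.
WP : Program → State → (State → Set) → Set
WP skip                   s Q = Q s
WP (x := e)               s Q = Q (setReg x (eval e s) s)
WP (a at x ← y)           s Q = Q (setArray a (regs s x) (regs s y) s)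
WP (p ︔ q)                s Q = WP p s (λ s′ → WP q s′ Q)
WP (if b then p else q)   s Q = (test b s ≡ true → WP p s Q) × (test b s ≡ false → WP q s Q)
WP (while b loop p)       s Q = ⊥

-- The branches of a conditional are added where a maximum would do: only some constant is wanted,
-- and either branch is then bounded at once.
cost : Program → ℕ
cost (p ︔ q)              = cost p + cost q
cost (if b then p else q) = suc (cost p + cost q)
cost _                    = 1

wp-sound : ∀ p {s Q} → WP p s Q → Runs (cost p) p s Q
wp-sound skip           x = _ , _ , ⇓skip , ≤-refl , x
wp-sound (_ := _)       x = _ , _ , ⇓assign , ≤-refl , x
wp-sound (_ at _ ← _)   x = _ , _ , ⇓store , ≤-refl , x
wp-sound (p ︔ q)        x = runs-seq (wp-sound p x) (λ _ → wp-sound q)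
wp-sound (if b then p else q) {s} (f , g) with test b s in eq
... | true  with s′ , _ , d , t≤ , x ← wp-sound p (f refl) =
  s′ , _ , ⇓then eq d , s≤s (≤-trans t≤ (m≤m+n _ _)) , x
... | false with s′ , _ , d , t≤ , x ← wp-sound q (g refl) =
  s′ , _ , ⇓else eq d , s≤s (≤-trans t≤ (m≤n+m _ _)) , x

-- Each unit of the variant pays for one run of the body, at most `K` steps, and the test before it;
-- the extra 1 is the final test, which fails.
loop-bound : ∀ K {k k′ t t′} → k′ < k → t ≤ K → t′ ≤ suc (suc K * k′) →
             suc (t + t′) ≤ suc (suc K * k)
loop-bound K {k} {k′} {t} {t′} k′<k t≤ t′≤ = s≤s (begin
  t + t′                   ≤⟨ +-mono-≤ t≤ t′≤ ⟩
  K + suc (suc K * k′)     ≡⟨ +-suc K _ ⟩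
  suc K + suc K * k′       ≡⟨ *-suc (suc K) k′ ⟨
  suc K * suc k′           ≤⟨ *-monoʳ-≤ (suc K) k′<k ⟩
  suc K * k                ∎)
  where open ≤-Reasoning

module _ {b p} (I : ℕ → State → Set)
  (body : ∀ {k s} → I k s → test b s ≡ true → WP p s (λ s′ → ∃[ k′ ] (k′ < k × I k′ s′))) where

  private
    Exit : State → Set
    Exit s = test b s ≡ false × ∃[ k ] I k s

    -- The variant may drop by more than one, so the recursion is on a bound `f` above it.
    fuelled : ∀ f {k s} → k < f → I k s → Runs (suc (suc (cost p) * k)) (while b loop p) s Exit
    fuelled (suc f) {k} {s} k<f i with test b s in eq
    ... | false = s , _ , ⇓exit eq , s≤s z≤n , eq , k , i
    ... | true with s′ , _ , d , t≤ , k′ , k′<k , i′ ← wp-sound p (body i eq)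
               with s″ , _ , d′ , t′≤ , exit ← fuelled f (<-≤-trans k′<k (≤-pred k<f)) i′ =
      s″ , _ , ⇓loop eq d d′ , loop-bound (cost p) k′<k t≤ t′≤ , exit

  runs-loop : ∀ {k s} → I k s → Runs (suc (suc (cost p) * k)) (while b loop p) s Exit
  runs-loop = fuelled _ ≤-refl

-- The stack l, its top being the last used cell.
Holds : (ℕ → ℕ) → List ℕ → Set
Holds f []      = ⊤
Holds f (x ∷ l) = f (List.length l) ≡ x × Holds f l

Holds-cong : ∀ {f g} l → (∀ {i} → i < List.length l → g i ≡ f i) → Holds f l → Holds g l
Holds-cong []      eq h       = tt
Holds-cong (x ∷ l) eq (p , h) = trans (eq ≤-refl) p , Holds-cong l (eq ∘ m≤n⇒m≤1+n) h

Holds-push : ∀ {f i x} l → i ≡ List.length l → Holds f l → Holds (f [ i ↦ x ]) (x ∷ l)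
Holds-push {f} l refl h = update-same f {List.length l} _ refl ,
  Holds-cong l (λ {j} j< → update-other f j (<⇒≢ j<)) h

-- A linked list of numbers; the pointer to e is 1 + e, and 0 is the null pointer.
data Chain (next : ℕ → ℕ) : ℕ → List ℕ → Set where
  nil  : ∀ {p} → p ≡ 0 → Chain next p []
  cons : ∀ {p e l} → p ≡ suc e → Chain next (next e) l → Chain next p (e ∷ l)

Chain-cong : ∀ {f g p l} → (∀ {e} → e ∈ l → g e ≡ f e) → Chain f p l → Chain g p l
Chain-cong eq (nil p≡0)    = nil p≡0
Chain-cong {g = g} eq (cons {l = l} p≡ c) =
  cons p≡ (subst (λ q → Chain g q l) (sym (eq (here refl))) (Chain-cong (eq ∘ there) c))

-- Finite sums and linear time bounds

sumTo : ℕ → (ℕ → ℕ) → ℕ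
sumTo zero    f = 0
sumTo (suc n) f = f n + sumTo n f

sumTo-cong : ∀ n {f g} → (∀ {y} → y < n → g y ≡ f y) → sumTo n g ≡ sumTo n f
sumTo-cong zero    eq = refl
sumTo-cong (suc n) eq = cong₂ _+_ (eq ≤-refl) (sumTo-cong n (eq ∘ m≤n⇒m≤1+n))

sumTo-const : ∀ n {f} c → (∀ {y} → y < n → f y ≡ c) → sumTo n f ≡ n * c
sumTo-const zero    c eq = refl
sumTo-const (suc n) c eq = cong₂ _+_ (eq ≤-refl) (sumTo-const n c (eq ∘ m≤n⇒m≤1+n))

-- The old and the new value at `x` stand on opposite sides, which expresses the change of the sum
-- without truncated subtraction.
sumTo-update : ∀ n {f g x} → x < n → (∀ y → y ≢ x → g y ≡ f y) →
               sumTo n g + f x ≡ sumTo n f + g x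
sumTo-update (suc n) {f} {g} {x} x< eq with x ≟ n
... | yes refl = begin
  g n + sumTo n g + f n    ≡⟨ cong (λ r → g n + r + f n) (sumTo-cong n λ y< → eq _ (<⇒≢ y<)) ⟩
  g n + sumTo n f + f n    ≡⟨ +-comm (g n + sumTo n f) (f n) ⟩
  f n + (g n + sumTo n f)  ≡⟨ cong (f n +_) (+-comm (g n) _) ⟩
  f n + (sumTo n f + g n)  ≡⟨ +-assoc (f n) _ _ ⟨
  f n + sumTo n f + g n    ∎
  where open ≡-Reasoning
... | no x≢n = begin
  g n + sumTo n g + f x    ≡⟨ +-assoc (g n) _ _ ⟩
  g n + (sumTo n g + f x)  ≡⟨ cong₂ _+_ (eq n (x≢n ∘ sym)) (sumTo-update n (≤∧≢⇒< (≤-pred x<) x≢n) eq) ⟩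
  f n + (sumTo n f + g x)  ≡⟨ +-assoc (f n) _ _ ⟨
  f n + sumTo n f + g x    ∎
  where open ≡-Reasoning

-- A record, so that `m` and `c` are found by unification; the product `c * suc m` would hide them.
-- With the factor m + 1, constant work is linear as well.
record Linear (m c : ℕ) (p : Program) (s : State) (Q : State → Set) : Set where
  constructor linear
  field
    runs : Runs (c * suc m) p s Q

linear-seq : ∀ {m c c′ p q s P Q} → Linear m c p s P → (∀ s′ → P s′ → Linear m c′ q s′ Q) →
             Linear m (c + c′) (p ︔ q) s Q
linear-seq {m} {c} {c′} (linear x) f = linear
  (runs-weaken (≤-reflexive (sym (*-distribʳ-+ (suc m) c c′))) (λ _ q → q)
    (runs-seq x (λ s′ y → Linear.runs (f s′ y))))

linear-assign : ∀ {m c x e q s Q} → Linear m c q (setReg x (eval e s) s) Q →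
                Linear m (suc c) (x := e ︔ q) s Q
linear-assign (linear (s′ , t , d , t≤ , x)) =
  linear (s′ , suc t , ⇓seq ⇓assign d , +-mono-≤ (s≤s z≤n) t≤ , x)

linear-wp : ∀ {m} p {s Q} → WP p s Q → Linear m (cost p) p s Q
linear-wp {m} p x = linear (runs-weaken (m≤m*n (cost p) (suc m)) (λ _ q → q) (wp-sound p x))

linear-map : ∀ {m c p s P Q} → (∀ s′ → P s′ → Q s′) → Linear m c p s P → Linear m c p s Q
linear-map f (linear x) = linear (runs-weaken ≤-refl f x)

linear-loop : ∀ {m b p} d (I : ℕ → State → Set) →
  (∀ {k s} → I k s → test b s ≡ true → WP p s (λ s′ → ∃[ k′ ] (k′ < k × I k′ s′))) →
  ∀ {k s} → I k s → k ≤ d * suc m →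
  Linear m (suc (suc (cost p) * d)) (while b loop p) s (λ s′ → test b s′ ≡ false × ∃[ k′ ] I k′ s′)
linear-loop {m} {p = p} d I body {k} i k≤ = linear (runs-weaken bound (λ _ q → q) (runs-loop I body i))
  where
  open ≤-Reasoning
  bound : suc (suc (cost p) * k) ≤ suc (suc (cost p) * d) * suc m
  bound = +-mono-≤ (s≤s z≤n) (begin
    suc (cost p) * k             ≤⟨ *-monoʳ-≤ (suc (cost p)) k≤ ⟩
    suc (cost p) * (d * suc m)   ≡⟨ *-assoc (suc (cost p)) d (suc m) ⟨
    suc (cost p) * d * suc m     ∎)

-- Depth-first search

-- Directed graphs with edges numbered 0, …, m − 1, the e-th one from src e to tgt e.
Arc : ℕ → (src tgt : ℕ → ℕ) → ℕ → ℕ → Set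
Arc m src tgt x y = ∃[ e ] (e < m × src e ≡ x × tgt e ≡ y)

Arc-flip : ∀ {m src tgt x y} → Arc m src tgt x y → Arc m tgt src y x
Arc-flip (e , e<m , p , q) = e , e<m , q , p

-- Reflexive at members, because the path to which it is applied may be empty. On a finishing order,
-- whose head finished last, it says that `u` finishes no earlier than `w`.
data Before : List ℕ → ℕ → ℕ → Set where
  here  : ∀ {l u w} → w ∈ u ∷ l → Before (u ∷ l) u w
  there : ∀ {x l u w} → Before l u w → Before (x ∷ l) u w

Before⇒∈ : ∀ {l u w} → Before l u w → w ∈ l
Before⇒∈ (here w∈)  = w∈
Before⇒∈ (there b) = there (Before⇒∈ b)

-- A `u` beyond `r` would need a second occurrence of `r` behind it, which uniqueness excludes.
Before-split : ∀ xs {r ys u} → Unique (xs ++ r ∷ ys) → Before (xs ++ r ∷ ys) u r → u ∈ xs ⊎ u ≡ r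
Before-split []       _         (here _)  = inj₂ refl
Before-split []       (r∉ ∷ _)  (there b) = contradiction refl (All.lookup r∉ (Before⇒∈ b))
Before-split (x ∷ xs) _         (here _)  = inj₁ (here refl)
Before-split (x ∷ xs) (_ ∷ uniq) (there b) with Before-split xs uniq b
... | inj₁ u∈xs = inj₁ (there u∈xs)
... | inj₂ u≡r  = inj₂ u≡r

module Search (n m : ℕ) (src tgt : ℕ → ℕ) (order : List ℕ) where

  E : ℕ → ℕ → Set
  E = Arc m src tgt

  _↝_ _∼_ : ℕ → ℕ → Set
  _↝_ = Star E
  x ∼ y = x ↝ y × y ↝ x

  -- `r` is the root of the tree of `v`. All that precedes it in `order` was tried earlier and
  -- belongs to older trees, so `r` is the first node of its label in `order`; the later
  -- identification of roots rests on this.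
  Rooted : (ℕ → ℕ) → ℕ → Set
  Rooted lab v = ∃[ r ] (lab r ≡ lab v × r ↝ v ×
    ∃[ xs ] ∃[ ys ] (order ≡ xs ++ r ∷ ys × (∀ {u} → u ∈ xs → 1 ≤ lab u × lab u < lab r)))

  -- The open nodes S form a path in the graph, deepest first; L lists the finished ones, last
  -- finished first; rest holds the roots still to be tried, and rem x the edges from x not yet
  -- followed.  A node of the i-th of the K trees opened so far has label i, any other one 0.
  record Invariant (S L rest : List ℕ) (lab : ℕ → ℕ) (rem : ℕ → List ℕ) (K : ℕ) : Set where
    field
      unique   : Unique (S ++ L)
      visited  : ∀ {x} → x ∈ S ++ L → x < n × 1 ≤ lab x × lab x ≤ K
      visited⁻ : ∀ {x} → x < n → 1 ≤ lab x → x ∈ S ++ L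
      path     : AllPairs (λ x y → y ↝ x) S
      current  : ∀ {x} → x ∈ S → lab x ≡ K
      closed   : ∀ {x y} → x ∈ L → E x y → 1 ≤ lab y × lab y ≤ lab x
      explored : ∀ {e} → e < m → e ∈ rem (src e) ⊎ 1 ≤ lab (tgt e)
      -- The claim is about the component of `u`, since `w` may well finish after `u` itself. It is
      -- postponed while that component has an open node; in the end some `u′` in it has finished no
      -- earlier than `w`.
      finished : ∀ {u w} → u ∈ L → u ↝ w →
                 (∃[ g ] (g ∈ S × g ∼ u)) ⊎ (∃[ u′ ] (u′ ∼ u × Before L u′ w))
      rooted   : ∀ {v} → v ∈ S ++ L → Rooted lab v
      scanned  : ∃[ xs ] (order ≡ xs ++ rest × (∀ {u} → u ∈ xs → 1 ≤ lab u × lab u ≤ K))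
      onto     : ∀ {i} → 1 ≤ i → i ≤ K → ∃[ v ] (v < n × lab v ≡ i)

  initial : ∀ {lab rem} → (∀ {x} → x < n → lab x ≡ 0) → (∀ {e} → e < m → e ∈ rem (src e)) →
            Invariant [] [] order lab rem 0
  initial {lab} lab≡0 all = record
    { unique   = []
    ; visited  = λ ()
    ; visited⁻ = λ x<n 1≤ → contradiction (subst (1 ≤_) (lab≡0 x<n) 1≤) λ ()
    ; path     = []
    ; current  = λ ()
    ; closed   = λ ()
    ; explored = inj₁ ∘ all
    ; finished = λ ()
    ; rooted   = λ ()
    ; scanned  = [] , refl , λ ()
    ; onto     = λ 1≤i i≤0 → contradiction (≤-trans 1≤i i≤0) λ ()
    }

  module _ {S L rest lab rem K} (inv : Invariant S L rest lab rem K) where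
    open Invariant inv

    module _ {x K′} (x-new : lab x ≡ 0) (K≤ : K ≤ K′) where

      private
        lab′ : ℕ → ℕ
        lab′ = lab [ x ↦ K′ ]

        stable : ∀ {y} → 1 ≤ lab y → lab′ y ≡ lab y
        stable {y} 1≤ = update-other lab y λ { refl → contradiction (subst (1 ≤_) x-new 1≤) λ () }

        at-x : lab′ x ≡ K′
        at-x = update-same lab x refl

      grows : ∀ {y} → 1 ≤ lab y → 1 ≤ lab′ y
      grows 1≤ = subst (1 ≤_) (sym (stable 1≤)) 1≤

      rooted-stable : ∀ {v} → 1 ≤ lab v → Rooted lab v → Rooted lab′ v
      rooted-stable {v} 1≤v (r , r≡v , r↝v , xs , ys , eq , smaller) =
        r , trans r′≡ (trans r≡v (sym (stable 1≤v))) , r↝v , xs , ys , eq ,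
        λ u∈ → let 1≤u , u<r = smaller u∈ ; u′≡ = sym (stable 1≤u) in
          subst (1 ≤_) u′≡ 1≤u , subst₂ _<_ u′≡ (sym r′≡) u<r
        where
        r′≡ = stable (subst (1 ≤_) (sym r≡v) 1≤v)

      -- Serves a root, with the fresh label `K + 1` and an empty stack, as well as a child, with
      -- the current label `K`. The invariant survives since `x` had label 0, so that no label
      -- already given changes.
      discover : x < n → 1 ≤ K′ → All (_↝ x) S → (∀ {y} → y ∈ S → lab y ≡ K′) →
                 (∀ {i} → 1 ≤ i → i ≤ K′ → i ≡ K′ ⊎ i ≤ K) → Rooted lab′ x →
                 Invariant (x ∷ S) L rest lab′ rem K′
      discover x<n 1≤K′ to-x S-label new-label x-rooted = record
        { unique   = All.tabulate (λ { y∈ refl → contradiction (subst (1 ≤_) x-new (proj₁ (proj₂ (visited y∈)))) λ () }) ∷ unique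
        ; visited  = λ where
            (here refl) → x<n , subst (1 ≤_) (sym at-x) 1≤K′ , ≤-reflexive at-x
            (there y∈)  → let y<n , 1≤ , ≤K = visited y∈ in
              y<n , grows 1≤ , ≤-trans (≤-reflexive (stable 1≤)) (≤-trans ≤K K≤)
        ; visited⁻ = visited⁻′
        ; path     = to-x ∷ path
        ; current  = λ where
            (here refl) → at-x
            (there y∈)  → trans (stable (proj₁ (proj₂ (visited (∈-++⁺ˡ y∈))))) (S-label y∈)
        ; closed   = λ y∈ z → let 1≤ , ≤y = closed y∈ z in
            grows 1≤ , subst₂ _≤_ (sym (stable 1≤)) (sym (stable (proj₁ (proj₂ (visited (∈-++⁺ʳ S y∈)))))) ≤y
        ; explored = λ e<m → case explored e<m of λ where
            (inj₁ e∈) → inj₁ e∈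
            (inj₂ 1≤) → inj₂ (grows 1≤)
        ; finished = λ u∈ p → case finished u∈ p of λ where
            (inj₁ (g , g∈ , g∼)) → inj₁ (g , there g∈ , g∼)
            (inj₂ b)             → inj₂ b
        ; rooted   = λ where
            (here refl) → x-rooted
            (there v∈)  → rooted-stable (proj₁ (proj₂ (visited v∈))) (rooted v∈)
        ; scanned  = let xs , eq , old = scanned in xs , eq , λ u∈ → let 1≤ , ≤K = old u∈ in
            grows 1≤ , ≤-trans (≤-reflexive (stable 1≤)) (≤-trans ≤K K≤)
        ; onto     = λ 1≤i i≤ → case new-label 1≤i i≤ of λ where
            (inj₁ refl) → x , x<n , at-x
            (inj₂ i≤K)  → let v , v<n , v≡ = onto 1≤i i≤K in
              v , v<n , trans (stable (subst (1 ≤_) (sym v≡) 1≤i)) v≡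
        }
        where
        visited⁻′ : ∀ {y} → y < n → 1 ≤ lab′ y → y ∈ x ∷ S ++ L
        visited⁻′ {y} y<n 1≤ with y ≟ x
        ... | yes refl = here refl
        ... | no  y≢x  = there (visited⁻ y<n (subst (1 ≤_) (update-other lab y y≢x) 1≤))

    skip-arc : ∀ {g e es} → rem g ≡ e ∷ es → 1 ≤ lab (tgt e) →
               ∀ {rem′ : ℕ → List ℕ} → rem′ g ≡ es → (∀ x → x ≢ g → rem′ x ≡ rem x) →
               Invariant S L rest lab rem′ K
    skip-arc {g} {e} {es} g-rem 1≤ {rem′} at-g other = record
      { unique = unique ; visited = visited ; visited⁻ = visited⁻ ; path = path
      ; current = current ; closed = closed ; finished = finished
      ; rooted = rooted ; scanned = scanned ; onto = onto
      ; explored = explored′ }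
      where
      explored′ : ∀ {f} → f < m → f ∈ rem′ (src f) ⊎ 1 ≤ lab (tgt f)
      explored′ {f} f<m with explored f<m
      ... | inj₂ 1≤f = inj₂ 1≤f
      ... | inj₁ f∈ with src f ≟ g
      ...   | no  ≢g   = inj₁ (subst (f ∈_) (sym (other _ ≢g)) f∈)
      ...   | yes refl with subst (f ∈_) g-rem f∈
      ...     | here refl = inj₂ 1≤
      ...     | there f∈es = inj₁ (subst (f ∈_) (sym at-g) f∈es)

  module _ {S L rest lab rem K r} (inv : Invariant S L (r ∷ rest) lab rem K) where
    open Invariant inv

    skip-root : 1 ≤ lab r → lab r ≤ K → Invariant S L rest lab rem K
    skip-root 1≤r r≤K = record
      { unique = unique ; visited = visited ; visited⁻ = visited⁻ ; path = path
      ; current = current ; closed = closed ; finished = finished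
      ; rooted = rooted ; explored = explored ; onto = onto
      ; scanned = let xs , eq , old = scanned in
          xs ++ r ∷ [] , trans eq (sym (++-assoc xs (r ∷ []) rest)) ,
          λ u∈ → case ∈-++⁻ xs u∈ of λ where
            (inj₁ u∈xs)        → old u∈xs
            (inj₂ (here refl)) → 1≤r , r≤K
      }

  new-root : ∀ {L rest lab rem K r} → Invariant [] L (r ∷ rest) lab rem K → r < n → lab r ≡ 0 →
             Invariant (r ∷ []) L rest (lab [ r ↦ suc K ]) rem (suc K)
  new-root {L} {rest} {lab} {rem} {K} {r} inv r<n r-new =
    -- Once labelled, `r` can leave the list of roots like any root found already visited.
    skip-root (discover inv r-new (n≤1+n K) r<n (s≤s z≤n) [] (λ ()) split r-rooted)
      (subst (1 ≤_) (sym at-r) (s≤s z≤n)) (≤-reflexive at-r)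
    where
    open Invariant inv
    at-r = update-same lab {r} {suc K} r refl

    split : ∀ {i} → 1 ≤ i → i ≤ suc K → i ≡ suc K ⊎ i ≤ K
    split _ i≤ = swap (case m≤n⇒m<n∨m≡n i≤ of λ where
      (inj₁ i<) → inj₁ (≤-pred i<)
      (inj₂ eq) → inj₂ eq)

    r-rooted : Rooted (lab [ r ↦ suc K ]) r
    r-rooted = let xs , eq , old = scanned in r , refl , ε , xs , rest , eq , λ {u} u∈ →
      let 1≤u , u≤K = old u∈
          u≡ = sym (update-other lab {r} {suc K} u λ { refl → contradiction (subst (1 ≤_) r-new 1≤u) λ () })
      in subst (1 ≤_) u≡ 1≤u , subst₂ _<_ u≡ (sym at-r) (s≤s u≤K)

  module _ (tgt<n : ∀ {e} → e < m → tgt e < n) where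

    push : ∀ {g S L rest lab rem K e es} → Invariant (g ∷ S) L rest lab rem K →
           e < m → src e ≡ g → rem g ≡ e ∷ es → lab (tgt e) ≡ 0 →
           ∀ {rem′ : ℕ → List ℕ} → rem′ g ≡ es → (∀ x → x ≢ g → rem′ x ≡ rem x) →
           Invariant (tgt e ∷ g ∷ S) L rest (lab [ tgt e ↦ K ]) rem′ K
    push {g} {S} {L} {rest} {lab} {rem} {K} {e} inv e<m src≡ g-rem w-new at-g other =
      skip-arc
        (discover inv w-new ≤-refl (tgt<n e<m) 1≤K
          ((arc ◅ ε) ∷ All.map (_◅◅ (arc ◅ ε)) (head path)) current
          (λ _ → inj₂) w-rooted)
        g-rem (subst (1 ≤_) (sym at-w) 1≤K) at-g other
      where
      open Invariant inv
      w = tgt e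
      at-w = update-same lab {w} {K} w refl
      g-label = current (here refl)
      g-visited = visited (here refl)
      1≤K = ≤-trans (proj₁ (proj₂ g-visited)) (proj₂ (proj₂ g-visited))

      arc : E g w
      arc = e , e<m , src≡ , refl

      head : ∀ {R : ℕ → ℕ → Set} {x xs} → AllPairs R (x ∷ xs) → All (R x) xs
      head (p ∷ _) = p

      w-rooted : Rooted (lab [ w ↦ K ]) w
      w-rooted with r , r≡ , r↝g , more ← rooted-stable inv w-new ≤-refl (proj₁ (proj₂ g-visited)) (rooted (here refl)) =
        r , trans r≡ (trans (update-other lab g λ { refl → contradiction (subst (1 ≤_) w-new (proj₁ (proj₂ g-visited))) λ () }) (trans g-label (sym at-w))) ,
        r↝g ◅◅ (arc ◅ ε) , more

    -- Every edge from `g` has been followed, so its target is labelled, and that label cannot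
    -- exceed `K`, the largest so far and the label of `g`. The delicate part is `finished`, for
    -- which `g` no longer counts as open.
    finish : ∀ {g S L rest lab rem K} → Invariant (g ∷ S) L rest lab rem K → rem g ≡ [] →
             Invariant S (g ∷ L) rest lab rem K
    finish {g} {S} {L} {rest} {lab} {rem} {K} inv done = record
      { unique   = Permutation.Unique-resp-↭ (setoid ℕ) (↭⇒↭ₛ moved) unique
      ; visited  = visited ∘ ↭.∈-resp-↭ (↭-sym moved)
      ; visited⁻ = λ x<n 1≤ → ↭.∈-resp-↭ moved (visited⁻ x<n 1≤)
      ; path     = tail path
      ; current  = current ∘ there
      ; closed   = λ { (here refl) → g-closed ; (there x∈) → closed x∈ }
      ; explored = explored
      ; finished = finished′
      ; rooted   = rooted ∘ ↭.∈-resp-↭ (↭-sym moved)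
      ; scanned  = scanned
      ; onto     = onto
      }
      where
      open Invariant inv

      moved : g ∷ S ++ L ↭ S ++ g ∷ L
      moved = ↭-sym (↭.shift g S L)

      tail : ∀ {R : ℕ → ℕ → Set} {x xs} → AllPairs R (x ∷ xs) → AllPairs R xs
      tail (_ ∷ p) = p

      above : ∀ {h} → h ∈ S → h ↝ g
      above h∈ with p ∷ _ ← path = All.lookup p h∈

      g-closed : ∀ {y} → E g y → 1 ≤ lab y × lab y ≤ lab g
      g-closed (e , e<m , refl , refl) with explored e<m
      ... | inj₁ e∈ with () ← subst (e ∈_) done e∈
      ... | inj₂ 1≤ = 1≤ , subst (_ ≤_) (sym (current (here refl))) (proj₂ (proj₂ (visited (visited⁻ (tgt<n e<m) 1≤))))

      -- A path from a finished node can leave the finished nodes only through the stack.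
      escape : ∀ {y w} → y ∈ g ∷ L → y ↝ w → w ∈ g ∷ L ⊎ ∃[ h ] (h ∈ S × y ↝ h)
      escape y∈ ε = inj₁ y∈
      escape {y} y∈ (_◅_ {j = y′} a@(e , e<m , _ , refl) p) with ∈-++⁻ S (↭.∈-resp-↭ moved (visited⁻ (tgt<n e<m) (1≤y′ y∈)))
        where
        1≤y′ : y ∈ g ∷ L → 1 ≤ lab y′
        1≤y′ (here refl) = proj₁ (g-closed a)
        1≤y′ (there y∈)  = proj₁ (closed y∈ a)
      ... | inj₁ y′∈S = inj₂ (y′ , y′∈S , a ◅ ε)
      ... | inj₂ y′∈ with escape y′∈ p
      ...   | inj₁ w∈            = inj₁ w∈
      ...   | inj₂ (h , h∈ , q) = inj₂ (h , h∈ , a ◅ q)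

      -- An open node `h` reached from `g` lies below it on the stack and hence reaches `g`: the two
      -- share a component, which still has an open node. Otherwise the path stays among finished
      -- nodes, and `g` heads their list.
      finished-g : ∀ {w} → g ↝ w → (∃[ h ] (h ∈ S × h ∼ g)) ⊎ Before (g ∷ L) g w
      finished-g p with escape (here refl) p
      ... | inj₁ w∈           = inj₂ (here w∈)
      ... | inj₂ (h , h∈ , q) = inj₁ (h , h∈ , above h∈ , q)

      finished′ : ∀ {u w} → u ∈ g ∷ L → u ↝ w →
                  (∃[ h ] (h ∈ S × h ∼ u)) ⊎ (∃[ u′ ] (u′ ∼ u × Before (g ∷ L) u′ w))
      finished′ (here refl) p with finished-g p
      ... | inj₁ h = inj₁ h
      ... | inj₂ b = inj₂ (g , (ε , ε) , b)
      finished′ (there u∈) p with finished u∈ p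
      ... | inj₂ (u′ , ∼u , b) = inj₂ (u′ , ∼u , there b)
      ... | inj₁ (h , there h∈ , ∼u) = inj₁ (h , h∈ , ∼u)
      -- The open node vouching for `u` was `g` itself. As `g ∼ u`, the path to `w` can be started
      -- at `g` instead, and the answer for `g` carries over.
      ... | inj₁ (_ , here refl , g↝u , u↝g) with finished-g (g↝u ◅◅ p)
      ...   | inj₁ (h , h∈ , h↝g , g↝h) = inj₁ (h , h∈ , h↝g ◅◅ g↝u , u↝g ◅◅ g↝h)
      ...   | inj₂ b = inj₂ (g , (g↝u , u↝g) , b)

-- Strongly connected components

module _ (n m : ℕ) (src tgt : ℕ → ℕ) where

  -- `before` is the one fact about finishing times on which the second search relies. Its `u′` may
  -- depend on `w`.
  record FinishingOrder (L : List ℕ) : Set where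
    open Search n m src tgt L
    field
      unique : Unique L
      nodes  : ∀ {x} → x ∈ L → x < n
      covers : ∀ {x} → x < n → x ∈ L
      before : ∀ {u w} → u < n → u ↝ w → ∃[ u′ ] (u′ ∼ u × Before L u′ w)

  -- `antitone` holds because no edge leads to a later tree: its target would have been visited from
  -- its source before that tree was opened.
  record SearchLabelling (order : List ℕ) (lab : ℕ → ℕ) (k : ℕ) : Set where
    open Search n m src tgt order
    field
      antitone : ∀ {x y} → E x y → lab y ≤ lab x
      rooted   : ∀ {x} → x < n → Rooted lab x
      range    : ∀ {x} → x < n → 1 ≤ lab x × lab x ≤ k
      onto     : ∀ {i} → 1 ≤ i → i ≤ k → ∃[ v ] (v < n × lab v ≡ i)

  module _ {order L lab rem K} (src<n : ∀ {e} → e < m → src e < n)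
    (covers : ∀ {x} → x < n → x ∈ order)
    (inv : Search.Invariant n m src tgt order [] L [] lab rem K) where
    open Search.Invariant inv

    private
      labelled : ∀ {x} → x < n → 1 ≤ lab x × lab x ≤ K
      labelled x<n = let xs , eq , old = scanned in
        old (subst (_ ∈_) (trans eq (++-identityʳ xs)) (covers x<n))

      black : ∀ {x} → x < n → x ∈ L
      black x<n = visited⁻ x<n (proj₁ (labelled x<n))

    finishingOrder : FinishingOrder L
    finishingOrder = record
      { unique = unique
      ; nodes  = proj₁ ∘ visited
      ; covers = black
      ; before = λ u<n p → case finished (black u<n) p of λ where
          (inj₁ (_ , () , _))
          (inj₂ b) → b
      }

    searchLabelling : SearchLabelling order lab K
    searchLabelling = record
      { antitone = λ { a@(e , e<m , refl , _) → proj₂ (closed (black (src<n e<m)) a) }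
      ; rooted   = rooted ∘ black
      ; range    = labelled
      ; onto     = onto
      }

-- The cases tell which of the two marked positions comes first; `same-root` excludes the strict
-- ones.
first-of : ∀ (xs xs′ : List ℕ) {r r′ ys ys′} → xs ++ r ∷ ys ≡ xs′ ++ r′ ∷ ys′ →
           r ∈ xs′ ⊎ r′ ∈ xs ⊎ r ≡ r′
first-of []       []         eq = inj₂ (inj₂ (proj₁ (∷-injective eq)))
first-of []       (x ∷ xs′)  eq = inj₁ (here (proj₁ (∷-injective eq)))
first-of (x ∷ xs) []         eq = inj₂ (inj₁ (here (sym (proj₁ (∷-injective eq)))))
first-of (x ∷ xs) (x′ ∷ xs′) eq with first-of xs xs′ (proj₂ (∷-injective eq))
... | inj₁ r∈         = inj₁ (there r∈)
... | inj₂ (inj₁ r′∈) = inj₂ (inj₁ (there r′∈))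
... | inj₂ (inj₂ r≡)  = inj₂ (inj₂ r≡)

-- Here `a e` and `b e` are the component numbers of the ends of edge `e`. The threshold `x` makes
-- both predicates monotone, so that an array of minima or maxima can be specified by the thresholds
-- it meets.
Leaves Enters : ℕ → (a b : ℕ → ℕ) → ℕ → ℕ → Set
Leaves m a b j x = ∃[ e ] (e < m × a e ≡ j × j < b e × b e ≤ x)
Enters m a b j x = ∃[ e ] (e < m × b e ≡ j × a e < j × x ≤ a e)

record Central (m : ℕ) (a b : ℕ → ℕ) (k i : ℕ) : Set where
  constructor central
  field
    1≤i    : 1 ≤ i
    i≤k    : i ≤ k
    leaves : ∀ {j} → 1 ≤ j → j < i → Leaves m a b j i
    enters : ∀ {j} → i < j → j ≤ k → Enters m a b j i

-- The second search of Kosaraju's algorithm, along the reversed edges.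
module Components {n m src tgt L lab k}
  (src<n : ∀ {e} → e < m → src e < n) (tgt<n : ∀ {e} → e < m → tgt e < n)
  (finishing : FinishingOrder n m src tgt L) (labelling : SearchLabelling n m tgt src L lab k) where

  open Search n m src tgt L using (E; _↝_; _∼_)
  open FinishingOrder finishing using (unique; before)
  open SearchLabelling labelling

  E-mono : ∀ {x y} → E x y → lab x ≤ lab y
  E-mono a = antitone (Arc-flip a)

  ↝-mono : ∀ {x y} → x ↝ y → lab x ≤ lab y
  ↝-mono ε       = ≤-refl
  ↝-mono (a ◅ p) = ≤-trans (E-mono a) (↝-mono p)

  -- The heart of Kosaraju's algorithm. Along the original edges `v` reaches its root `r`, so some
  -- `v′ ∼ v` stands in `L` at or before `r`. If strictly before, its label would be smaller than
  -- that of `r`, which is that of `v`; but labels are constant on components. Hence `v′` is `r`.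
  root : ∀ {v} (v<n : v < n) → proj₁ (rooted v<n) ∼ v
  root {v} v<n with rooted v<n
  ... | r , r≡v , r↝v , xs , ys , refl , smaller
    with v′ , (v′↝v , v↝v′) , b ← before v<n (reverse Arc-flip r↝v)
    with Before-split xs unique b
  ...   | inj₂ refl = v′↝v , v↝v′
  ...   | inj₁ v′∈  = contradiction (≤-antisym (↝-mono v′↝v) (↝-mono v↝v′))
            (<⇒≢ (subst (lab v′ <_) r≡v (proj₂ (smaller v′∈))))

  -- If one root came earlier in `L`, it would have a strictly smaller label than the other.
  same-root : ∀ {x y} (x<n : x < n) (y<n : y < n) → lab x ≡ lab y →
              proj₁ (rooted x<n) ≡ proj₁ (rooted y<n)
  same-root x<n y<n eq
    with r , r≡ , _ , xs , _ , L≡ , smaller ← rooted x<n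
       | r′ , r′≡ , _ , xs′ , _ , L≡′ , smaller′ ← rooted y<n
    with first-of xs xs′ (trans (sym L≡) L≡′)
  ... | inj₁ r∈         = contradiction (trans r≡ (trans eq (sym r′≡))) (<⇒≢ (proj₂ (smaller′ r∈)))
  ... | inj₂ (inj₁ r′∈) = contradiction (trans r′≡ (trans (sym eq) (sym r≡))) (<⇒≢ (proj₂ (smaller r′∈)))
  ... | inj₂ (inj₂ r≡r′) = r≡r′

  lab-≡⇒↝ : ∀ {x y} → x < n → y < n → lab x ≡ lab y → x ↝ y
  lab-≡⇒↝ x<n y<n eq with root x<n | root y<n | same-root x<n y<n eq
  ... | _ , x↝r | r↝y , _ | r≡r = x↝r ◅◅ subst (_↝ _) (sym r≡r) r↝y

  a b : ℕ → ℕ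
  a e = lab (src e)
  b e = lab (tgt e)

  module _ {c} (c<n : c < n) where

    module _ (good : Central m a b k (lab c)) where
      open Central good

      -- Walk inside the component of `x` to the tail of an edge that `leaves` provides, cross it
      -- into a later component not beyond that of `c`, and repeat; `f` bounds the number of labels
      -- still to climb.
      ascend : ∀ f {x} → x < n → lab x ≤ lab c → lab c ≤ lab x + f → x ↝ c
      ascend f {x} x<n x≤c c≤ with m≤n⇒m<n∨m≡n x≤c
      ... | inj₂ eq = lab-≡⇒↝ x<n c<n eq
      ascend zero    {x} x<n x≤c c≤ | inj₁ x<c = contradiction (subst (lab c ≤_) (+-identityʳ _) c≤) (<⇒≱ x<c)
      ascend (suc f) {x} x<n x≤c c≤ | inj₁ x<c
        with e , e<m , eq , x<b , b≤c ← leaves (proj₁ (range x<n)) x<c =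
        lab-≡⇒↝ x<n (src<n e<m) (sym eq) ◅◅ (e , e<m , refl , refl) ◅
        ascend f (tgt<n e<m) b≤c (≤-trans (subst (lab c ≤_) (+-suc (lab x) f) c≤) (+-monoˡ-≤ f x<b))

      descend : ∀ f {x} → x < n → lab c ≤ lab x → lab x ≤ lab c + f → c ↝ x
      descend f {x} x<n c≤x x≤ with m≤n⇒m<n∨m≡n c≤x
      ... | inj₂ eq = lab-≡⇒↝ c<n x<n eq
      descend zero    {x} x<n c≤x x≤ | inj₁ c<x = contradiction (subst (lab x ≤_) (+-identityʳ _) x≤) (<⇒≱ c<x)
      descend (suc f) {x} x<n c≤x x≤ | inj₁ c<x
        with e , e<m , eq , a<x , c≤a ← enters c<x (proj₂ (range x<n)) =
        descend f (src<n e<m) c≤a (≤-pred (≤-trans a<x (subst (lab x ≤_) (+-suc (lab c) f) x≤))) ◅◅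
        (e , e<m , refl , refl) ◅ lab-≡⇒↝ (tgt<n e<m) x<n eq

      central⇒comparable : ∀ {v} → v < n → c ↝ v ⊎ v ↝ c
      central⇒comparable {v} v<n with ≤-total (lab v) (lab c)
      ... | inj₁ v≤c = inj₂ (ascend (lab c) v<n v≤c (m≤n+m _ _))
      ... | inj₂ c≤v = inj₁ (descend (lab v) v<n c≤v (m≤n+m _ _))

  -- The witness is the first edge of the path at which the label changes; monotonicity keeps the
  -- new label at most that of `c`.
  leave : ∀ {v c} → v ↝ c → lab v < lab c → Leaves m a b (lab v) (lab c)
  leave ε v<v = contradiction v<v (<-irrefl refl)
  leave {v} {c} (_◅_ {j = y} arc@(e , e<m , refl , refl) p) v<c with m≤n⇒m<n∨m≡n (E-mono arc)
  ... | inj₁ v<y = e , e<m , refl , v<y , ↝-mono p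
  ... | inj₂ eq  = subst (λ l → Leaves m a b l (lab c)) (sym eq) (leave p (subst (_< lab c) eq v<c))

  -- The witness is the edge by which the path first enters the component of `v`; its tail is
  -- labelled at least as high as `c`.
  enter : ∀ {c v} → c ↝ v → lab c < lab v → Enters m a b (lab v) (lab c)
  enter ε v<v = contradiction v<v (<-irrefl refl)
  enter {c} {v} (_◅_ {j = y} arc@(e , e<m , refl , refl) p) c<v with m≤n⇒m<n∨m≡n (↝-mono p)
  ... | inj₂ eq  = e , e<m , eq , c<v , ≤-refl
  ... | inj₁ y<v with f , f<m , f≡ , f< , y≤ ← enter p y<v = f , f<m , f≡ , f< , ≤-trans (E-mono arc) y≤

  -- `onto` picks a node of component `j`. Monotone labels leave one direction in which it can be
  -- connected with `c`, and that path contains the edge sought.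
  comparable⇒central : ∀ {c} → c < n → (∀ {v} → v < n → v ≢ c → c ↝ v ⊎ v ↝ c) →
                       Central m a b k (lab c)
  comparable⇒central {c} c<n comparable = central (proj₁ (range c<n)) (proj₂ (range c<n)) leaves enters
    where
    leaves : ∀ {j} → 1 ≤ j → j < lab c → Leaves m a b j (lab c)
    leaves 1≤j j<c with onto 1≤j (≤-trans (<⇒≤ j<c) (proj₂ (range c<n)))
    ... | v , v<n , refl with comparable v<n (λ { refl → <-irrefl refl j<c })
    ...   | inj₁ c↝v = contradiction (↝-mono c↝v) (<⇒≱ j<c)
    ...   | inj₂ v↝c = leave v↝c j<c

    enters : ∀ {j} → lab c < j → j ≤ k → Enters m a b j (lab c)
    enters c<j j≤k with onto (≤-trans (s≤s z≤n) c<j) j≤k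
    ... | v , v<n , refl with comparable v<n (λ { refl → <-irrefl refl c<j })
    ...   | inj₁ c↝v = enter c↝v c<j
    ...   | inj₂ v↝c = contradiction (↝-mono v↝c) (<⇒≱ c<j)

  central-node : ∀ {i} → Central m a b k i → ∃[ c ] (c < n × (∀ {v} → v < n → c ↝ v ⊎ v ↝ c))
  central-node good with c , c<n , refl ← onto (Central.1≤i good) (Central.i≤k good) =
    c , c<n , central⇒comparable c<n good

-- The programs

-- rN and rM keep the input n and m throughout the search, and rZero is never written.
rN rM rZero rI rHeight rCount rLabel rA rB rC rD rPending rResult : Register
rN = 0 ; rM = 1 ; rZero = 2 ; rI = 3 ; rHeight = 4 ; rCount = 5 ; rLabel = 6
rA = 7 ; rB = 8 ; rC = 9 ; rD = 10 ; rPending = 11 ; rResult = 12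

aTgt aSrc aFirst aNext aOrder aLabel aStack aOut aMin aMax aSuffix : Array
aSrc = 0 ; aTgt = 1 ; aFirst = 2 ; aNext = 3 ; aOrder = 4 ; aLabel = 5
aStack = 6 ; aOut = 7 ; aMin = 8 ; aMax = 9 ; aSuffix = 10

fillBody resetBody listBody rootBody nodeBody searchBody : Program
fillBody = aOut at rI ← rI ︔ rI := inc rI

-- The list in `aOut`, for the second pass a finishing order, becomes the order of the roots; it is
-- copied because the search overwrites `aOut`.
resetBody =
  rA := aOut at rI ︔ aOrder at rI ← rA ︔ aLabel at rI ← rZero ︔
  aFirst at rI ← rZero ︔ rI := inc rI

-- Also reverses the edge: a pass follows it from aTgt to aSrc, and the next pass searches the
-- converse graph.
listBody =
  rA := aSrc at rI ︔ rB := aTgt at rI ︔ aSrc at rI ← rB ︔ aTgt at rI ← rA ︔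
  rC := aFirst at rA ︔ aNext at rI ← rC ︔ rI := inc rI ︔ aFirst at rA ← rI

-- `rPending` counts the untried roots and the open nodes together, so that one comparison controls
-- the loop. Opening a root turns one into the other and leaves the count unchanged.
rootBody =
  rI := dec rI ︔ rA := aOrder at rI ︔ rB := aLabel at rA ︔
  (if rB ≐ rZero
   then rLabel := inc rLabel ︔ aLabel at rA ← rLabel ︔
     aStack at rHeight ← rA ︔ rHeight := inc rHeight
   else (rPending := dec rPending))

nodeBody =
  rB := dec rHeight ︔ rA := aStack at rB ︔ rC := aFirst at rA ︔
  (if rC ≐ rZero
   then aOut at rCount ← rA ︔ rCount := inc rCount ︔
     rHeight := reg rB ︔ rPending := dec rPending
   -- `aFirst` doubles as a bookmark: it is advanced past the edge, so each edge is followed once,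
   -- and the scan of the node resumes there when its child is finished.
   else (rC := dec rC ︔ rD := aNext at rC ︔ aFirst at rA ← rD ︔
     rA := aSrc at rC ︔ rB := aLabel at rA ︔
     (if rB ≐ rZero
      then aLabel at rA ← rLabel ︔ aStack at rHeight ← rA ︔
        rHeight := inc rHeight ︔ rPending := inc rPending
      else skip)))

searchBody = if rHeight ≐ rZero then rootBody else nodeBody

pass : Program
pass =
  rI := const 0 ︔ (while rI ≺ rN loop resetBody) ︔
  rI := const 0 ︔ (while rI ≺ rM loop listBody) ︔
  rI := reg rCount ︔ rPending := reg rCount ︔ rCount := const 0 ︔
  rLabel := const 0 ︔ rHeight := const 0 ︔ (while rZero ≺ rPending loop searchBody)

-- Shaped after the derivation in `pass-correct`. The factors 1, 1 and 4 bound the iterations of the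
-- three loops in units of m + 1.
passCost : ℕ
passCost = suc (suc (suc (cost resetBody) * 1) + suc (suc (suc (cost listBody) * 1) +
           (5 + suc (suc (cost searchBody) * 4))))

-- What the passes must preserve. `aMin`, `aMax` and `rResult` are first written by the sweep, which
-- starts from their zeros.
record Fixed (n m : ℕ) (s : State) : Set where
  field
    n≡   : regs s rN ≡ n
    m≡   : regs s rM ≡ m
    z≡   : regs s rZero ≡ 0
    res≡ : regs s rResult ≡ 0
    min≡ : ∀ x → arrays s aMin x ≡ 0
    max≡ : ∀ x → arrays s aMax x ≡ 0

record Arcs (m : ℕ) (src tgt : ℕ → ℕ) (s : State) : Set where
  field
    src≡ : ∀ {e} → e < m → arrays s aSrc e ≡ src e
    tgt≡ : ∀ {e} → e < m → arrays s aTgt e ≡ tgt e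

record Listing (n : ℕ) (order : List ℕ) (s : State) : Set where
  field
    holds  : Holds (arrays s aOut) order
    count≡ : regs s rCount ≡ List.length order
    short  : List.length order ≤ n
    nodes  : ∀ {x} → x ∈ order → x < n
    covers : ∀ {x} → x < n → x ∈ order

record Ready (n m : ℕ) (src tgt : ℕ → ℕ) (order : List ℕ) (s : State) : Set where
  field
    fixed   : Fixed n m s
    arcs    : Arcs m src tgt s
    listing : Listing n order s

-- Correctness and cost of one pass

unvisited : ℕ → ℕ
unvisited zero    = 1
unvisited (suc _) = 0

module Pass (n m : ℕ) (n≤ : n ≤ suc m) (src tgt : ℕ → ℕ)
  (src<n : ∀ {e} → e < m → src e < n) (tgt<n : ∀ {e} → e < m → tgt e < n) where

  record Resetting (order : List ℕ) (k : ℕ) (s : State) : Set where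
    field
      ready  : Ready n m src tgt order s
      left   : k + regs s rI ≡ n
      copied : ∀ {i} → i < regs s rI → arrays s aOrder i ≡ arrays s aOut i
      blank  : ∀ {i} → i < regs s rI → arrays s aLabel i ≡ 0
      empty  : ∀ {i} → i < regs s rI → arrays s aFirst i ≡ 0

  reset-step : ∀ {order k s} → Resetting order k s → test (rI ≺ rN) s ≡ true →
               WP resetBody s (λ s′ → ∃[ k′ ] (k′ < k × Resetting order k′ s′))
  reset-step {k = zero} {s} r t = contradiction (<ᵇ-true t) (<-irrefl (trans left (sym n≡)))
    where
    open Resetting r
    open Ready ready
    open Fixed fixed
  reset-step {k = suc k} {s} r t = k , ≤-refl , record
    -- Repacking the fields retypes each record at the new state: what they mention lies outside the
    -- registers and cells written, so the values agree by computation.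
    { ready  = record { fixed = record { Fixed fixed } ; arcs = record { Arcs arcs } ; listing = record { Listing listing } }
    ; left   = trans (+-suc k _) left
    ; copied = λ {i} i< → case i ≟ regs s rI of λ where
        (yes refl) → update-same (arrays s aOrder) {i} i refl
        (no ≢)     → trans (update-other (arrays s aOrder) i ≢) (copied (≤∧≢⇒< (≤-pred i<) ≢))
    ; blank  = λ {i} i< → case i ≟ regs s rI of λ where
        (yes refl) → trans (update-same (arrays s aLabel) {i} i refl) (Fixed.z≡ fixed)
        (no ≢)     → trans (update-other (arrays s aLabel) i ≢) (blank (≤∧≢⇒< (≤-pred i<) ≢))
    ; empty  = λ {i} i< → case i ≟ regs s rI of λ where
        (yes refl) → trans (update-same (arrays s aFirst) {i} i refl) (Fixed.z≡ fixed)
        (no ≢)     → trans (update-other (arrays s aFirst) i ≢) (empty (≤∧≢⇒< (≤-pred i<) ≢))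
    }
    where
    open Resetting r
    open Ready ready

  -- The edges below `rI` are already reversed in the arrays and listed under their original tails.
  -- `total` counts the listed edges, so that the search can be charged for them.
  record Bucketing (order : List ℕ) (k : ℕ) (s : State) : Set where
    field
      fixed   : Fixed n m s
      listing : Listing n order s
      copied  : ∀ {i} → i < n → arrays s aOrder i ≡ arrays s aOut i
      blank   : ∀ {i} → i < n → arrays s aLabel i ≡ 0
      left    : k + regs s rI ≡ m
      src-old : ∀ {e} → e < m → regs s rI ≤ e → arrays s aSrc e ≡ src e
      tgt-old : ∀ {e} → e < m → regs s rI ≤ e → arrays s aTgt e ≡ tgt e
      src-new : ∀ {e} → e < regs s rI → arrays s aSrc e ≡ tgt e
      tgt-new : ∀ {e} → e < regs s rI → arrays s aTgt e ≡ src e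
      rem     : ℕ → List ℕ
      chains  : ∀ {x} → x < n → Chain (arrays s aNext) (arrays s aFirst x) (rem x)
      rem-all : ∀ {e} → e < regs s rI → e ∈ rem (src e)
      rem-src : ∀ {x e} → e ∈ rem x → e < regs s rI × src e ≡ x
      total   : sumTo n (List.length ∘ rem) ≡ regs s rI

  list-step : ∀ {order k s} → Bucketing order k s → test (rI ≺ rM) s ≡ true →
              WP listBody s (λ s′ → ∃[ k′ ] (k′ < k × Bucketing order k′ s′))
  list-step {k = zero} {s} r t = contradiction (<ᵇ-true t) (<-irrefl (trans left (sym m≡)))
    where
    open Bucketing r
    open Fixed fixed
  list-step {order} {suc k} {s} r t = k , ≤-refl , step (src-old i<m ≤-refl) (tgt-old i<m ≤-refl)
    where
    open Bucketing r
    i = regs s rI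

    i<m : i < m
    i<m = subst (i <_) (Fixed.m≡ fixed) (<ᵇ-true t)

    -- With the loaded ends abstracted to `x` and `y`, matching on `refl` puts `src i` and `tgt i`
    -- in their place throughout the state.
    s′ : ℕ → ℕ → State
    s′ x y = setArray aFirst x (suc i) (setReg rI (suc i) (setArray aNext i (arrays s aFirst x) (setReg rC (arrays s aFirst x)
             (setArray aTgt i x (setArray aSrc i y (setReg rB y (setReg rA x s)))))))

    step : ∀ {x y} → x ≡ src i → y ≡ tgt i → Bucketing order k (s′ x y)
    step refl refl = record
      { fixed   = record { Fixed fixed }
      ; listing = record { Listing listing }
      ; copied  = copied
      ; blank   = blank
      ; left    = trans (+-suc k _) left
      ; src-old = λ {e} e<m i<e → trans (update-other (arrays s aSrc) e (>⇒≢ i<e)) (src-old e<m (<⇒≤ i<e))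
      ; tgt-old = λ {e} e<m i<e → trans (update-other (arrays s aTgt) e (>⇒≢ i<e)) (tgt-old e<m (<⇒≤ i<e))
      ; src-new = λ {e} e< → case e ≟ i of λ where
          (yes refl) → update-same (arrays s aSrc) {i} i refl
          (no ≢)     → trans (update-other (arrays s aSrc) e ≢) (src-new (≤∧≢⇒< (≤-pred e<) ≢))
      ; tgt-new = λ {e} e< → case e ≟ i of λ where
          (yes refl) → update-same (arrays s aTgt) {i} i refl
          (no ≢)     → trans (update-other (arrays s aTgt) e ≢) (tgt-new (≤∧≢⇒< (≤-pred e<) ≢))
      ; rem     = rem [ src i ↦ i ∷ rem (src i) ]
      ; chains  = chains′
      ; rem-all = rem-all′
      ; rem-src = rem-src′
      ; total   = +-cancelʳ-≡ (List.length (rem (src i))) _ _ (begin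
          sumTo n (List.length ∘ rem′) + List.length (rem (src i))  ≡⟨ sumTo-update n (src<n i<m) (λ y ≢ → cong List.length (update-other rem y ≢)) ⟩
          sumTo n (List.length ∘ rem) + List.length (rem′ (src i))  ≡⟨ cong₂ _+_ total (cong List.length (update-same rem (src i) refl)) ⟩
          i + suc (List.length (rem (src i)))                  ≡⟨ +-suc i _ ⟩
          suc i + List.length (rem (src i))                    ∎)
      }
      where
      open ≡-Reasoning
      rem′ = rem [ src i ↦ i ∷ rem (src i) ]
      next′ = arrays s aNext [ i ↦ arrays s aFirst (src i) ]

      old-chain : ∀ {x} → x < n → Chain next′ (arrays s aFirst x) (rem x)
      old-chain x<n = Chain-cong (λ {e} e∈ → update-other (arrays s aNext) e (<⇒≢ (proj₁ (rem-src e∈)))) (chains x<n)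

      chains′ : ∀ {x} → x < n → Chain next′ ((arrays s aFirst [ src i ↦ suc i ]) x) (rem′ x)
      chains′ {x} x<n with x ≟ src i
      ... | yes refl = subst (Chain next′ _) (sym (update-same rem x refl))
                         (cons (update-same (arrays s aFirst) x refl)
                           (subst (λ p → Chain next′ p (rem x)) (sym (update-same (arrays s aNext) i refl)) (old-chain x<n)))
      ... | no ≢     = subst₂ (Chain next′) (sym (update-other (arrays s aFirst) x ≢)) (sym (update-other rem x ≢)) (old-chain x<n)

      rem-all′ : ∀ {e} → e < suc i → e ∈ rem′ (src e)
      rem-all′ {e} e< with e ≟ i
      ... | yes refl = subst (e ∈_) (sym (update-same rem (src e) refl)) (here refl)
      ... | no e≢ with src e ≟ src i
      ...   | yes eq = subst (e ∈_) (sym (update-same rem (src e) eq))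
                         (there (subst (λ x → e ∈ rem x) eq (rem-all (≤∧≢⇒< (≤-pred e<) e≢))))
      ...   | no ≢   = subst (e ∈_) (sym (update-other rem (src e) ≢)) (rem-all (≤∧≢⇒< (≤-pred e<) e≢))

      rem-src′ : ∀ {x e} → e ∈ rem′ x → e < suc i × src e ≡ x
      rem-src′ {x} {e} e∈ with x ≟ src i
      ... | no ≢ = let e< , eq = rem-src (subst (e ∈_) (update-other rem x ≢) e∈) in m≤n⇒m≤1+n e< , eq
      ... | yes refl with subst (e ∈_) (update-same rem x refl) e∈
      ...   | here refl = ≤-refl , refl
      ...   | there e∈′ = let e< , eq = rem-src e∈′ in m≤n⇒m≤1+n e< , eq

  module Loop (order : List ℕ) where
    open Search n m src tgt order

    -- An unvisited node costs two steps, one to open and one to finish it.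
    measure : (S rest : List ℕ) (lab : ℕ → ℕ) (rem : ℕ → List ℕ) → ℕ
    measure S rest lab rem =
      sumTo n (unvisited ∘ lab) + sumTo n (unvisited ∘ lab) +
      (List.length S + (sumTo n (List.length ∘ rem) + List.length rest))

    record Searching (S L rest : List ℕ) (rem : ℕ → List ℕ) (k : ℕ) (s : State) : Set where
      field
        fixed    : Fixed n m s
        arcs     : Arcs m tgt src s
        inv      : Invariant S L rest (arrays s aLabel) rem (regs s rLabel)
        chains   : ∀ {x} → x < n → Chain (arrays s aNext) (arrays s aFirst x) (rem x)
        rem-src  : ∀ {x e} → e ∈ rem x → e < m × src e ≡ x
        stack    : Holds (arrays s aStack) S
        out      : Holds (arrays s aOut) L
        roots    : Holds (arrays s aOrder) rest
        nodes    : ∀ {x} → x ∈ rest → x < n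
        i≡       : regs s rI ≡ List.length rest
        height≡  : regs s rHeight ≡ List.length S
        count≡   : regs s rCount ≡ List.length L
        pending≡ : regs s rPending ≡ List.length rest + List.length S
        k≡       : k ≡ measure S rest (arrays s aLabel) rem
        -- Counted against the unvisited nodes, the last two bounds yield at the end at most `n`
        -- finished nodes and at most `n` labels, from which the next pass and the sweep take their
        -- iteration bounds.
        room     : List.length S + List.length L + sumTo n (unvisited ∘ arrays s aLabel) ≤ n
        labels   : regs s rLabel + sumTo n (unvisited ∘ arrays s aLabel) ≤ n

    SomeSearch : ℕ → State → Set
    SomeSearch k s = ∃[ S ] ∃[ L ] ∃[ rest ] ∃[ rem ] Searching S L rest rem k s

    Next : ℕ → State → Set
    Next k s′ = ∃[ k′ ] (k′ < k × SomeSearch k′ s′)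

    visit-unvisited : ∀ {lab : ℕ → ℕ} {x K} → x < n → lab x ≡ 0 → 1 ≤ K →
                      sumTo n (unvisited ∘ lab) ≡ suc (sumTo n (unvisited ∘ (lab [ x ↦ K ])))
    visit-unvisited {lab} {x} {suc K} x<n new (s≤s _) = sym (begin
      suc U′                           ≡⟨ +-comm 1 U′ ⟩
      U′ + 1                           ≡⟨ cong (λ l → U′ + unvisited l) new ⟨
      U′ + unvisited (lab x)           ≡⟨ sumTo-update n x<n (λ y ≢ → cong unvisited (update-other lab y ≢)) ⟩
      U + unvisited ((lab [ x ↦ suc K ]) x)  ≡⟨ cong (λ l → U + unvisited l) (update-same lab x refl) ⟩
      U + 0                            ≡⟨ +-identityʳ U ⟩
      U                                ∎)
      where
      open ≡-Reasoning
      U  = sumTo n (unvisited ∘ lab)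
      U′ = sumTo n (unvisited ∘ (lab [ x ↦ suc K ]))

    shrink : ∀ {rem : ℕ → List ℕ} {g e es} → g < n → rem g ≡ e ∷ es →
             sumTo n (List.length ∘ rem) ≡ suc (sumTo n (List.length ∘ (rem [ g ↦ es ])))
    shrink {rem} {g} {e} {es} g<n eq = sym (+-cancelʳ-≡ (List.length es) _ _ (begin
      suc A′ + List.length es                  ≡⟨ +-suc A′ (List.length es) ⟨
      A′ + suc (List.length es)                ≡⟨ cong (λ l → A′ + List.length l) eq ⟨
      A′ + List.length (rem g)                 ≡⟨ sumTo-update n g<n (λ y ≢ → cong List.length (update-other rem y ≢)) ⟩
      A + List.length ((rem [ g ↦ es ]) g)     ≡⟨ cong (λ l → A + List.length l) (update-same rem g refl) ⟩
      A + List.length es                       ∎))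
      where
      open ≡-Reasoning
      A  = sumTo n (List.length ∘ rem)
      A′ = sumTo n (List.length ∘ (rem [ g ↦ es ]))

    root-step : ∀ {k s L r rest rem} → Searching [] L (r ∷ rest) rem k s →
                arrays s aOrder (pred (regs s rI)) ≡ r → WP rootBody s (Next k)
    root-step {k} {s} {L} {r} {rest} {rem} q refl = new , old
      where
      open Searching q
      U = sumTo n (unvisited ∘ arrays s aLabel)
      A = sumTo n (List.length ∘ rem)
      r<n = nodes (here refl)

      popped pushed skipped : State
      popped  = setReg rB (arrays s aLabel r) (setReg rA r (setReg rI (pred (regs s rI)) s))
      pushed  = setReg rHeight (suc (regs s rHeight)) (setArray aStack (regs s rHeight) r
                (setArray aLabel r (suc (regs s rLabel)) (setReg rLabel (suc (regs s rLabel)) popped)))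
      skipped = setReg rPending (pred (regs s rPending)) popped

      new : (arrays s aLabel r ≡ᵇ regs s rZero) ≡ true → Next k pushed
      new t = measure (r ∷ []) rest (arrays pushed aLabel) rem ,
        subst (measure (r ∷ []) rest (arrays pushed aLabel) rem <_) (sym k≡) (fewer U≡) ,
        _ , _ , _ , rem , record
        { fixed    = record { Fixed fixed }
        ; arcs     = record { Arcs arcs }
        ; inv      = new-root inv r<n lab≡0
        ; chains   = chains
        ; rem-src  = rem-src
        ; stack    = Holds-push [] height≡ tt
        ; out      = out
        ; roots    = proj₂ roots
        ; nodes    = nodes ∘ there
        ; i≡       = cong pred i≡
        ; height≡  = cong suc height≡
        ; count≡   = count≡
        ; pending≡ = trans pending≡ (sym (+-suc (List.length rest) 0))
        ; k≡       = refl
        ; room     = subst (_≤ n) (trans (cong (List.length L +_) U≡) (+-suc _ _)) room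
        ; labels   = subst (_≤ n) (trans (cong (regs s rLabel +_) U≡) (+-suc _ _)) labels
        }
        where
        lab≡0 = trans (≡ᵇ-true t) (Fixed.z≡ fixed)
        U≡ = visit-unvisited r<n lab≡0 (s≤s z≤n)
        identity : ∀ U A R → suc (suc (U + U + (1 + (A + R)))) ≡ suc U + suc U + (0 + (A + suc R))
        identity = solve-∀
        -- The root moves from `rest` to the stack, so the measure falls by exactly the two units
        -- held by an unvisited node.
        fewer : ∀ {U U′ A R} → U ≡ suc U′ → U′ + U′ + (1 + (A + R)) < U + U + (0 + (A + suc R))
        fewer {U′ = U′} {A} {R} refl = ≤-trans (n≤1+n _) (≤-reflexive (identity U′ A R))

      old : (arrays s aLabel r ≡ᵇ regs s rZero) ≡ false → Next k skipped
      old t = measure [] rest (arrays s aLabel) rem ,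
        subst (measure [] rest (arrays s aLabel) rem <_) (sym k≡) (+-monoʳ-< (U + U) (+-monoʳ-< A ≤-refl)) ,
        _ , _ , _ , rem , record
        { fixed    = record { Fixed fixed }
        ; arcs     = record { Arcs arcs }
        ; inv      = skip-root inv 1≤r
                       (proj₂ (proj₂ (Invariant.visited inv (Invariant.visited⁻ inv r<n 1≤r))))
        ; chains   = chains
        ; rem-src  = rem-src
        ; stack    = tt
        ; out      = out
        ; roots    = proj₂ roots
        ; nodes    = nodes ∘ there
        ; i≡       = cong pred i≡
        ; height≡  = height≡
        ; count≡   = count≡
        ; pending≡ = cong pred pending≡
        ; k≡       = refl
        ; room     = room
        ; labels   = labels
        }
        where
        1≤r = n≢0⇒n>0 λ r≡0 → ≡ᵇ-false t (trans r≡0 (sym (Fixed.z≡ fixed)))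

    chain-nil : ∀ {next p l} → Chain next p l → p ≡ 0 → l ≡ []
    chain-nil (nil _)     _ = refl
    chain-nil (cons () _) refl

    chain-cons : ∀ {next p l} → Chain next p l → p ≢ 0 →
                 ∃[ es ] (l ≡ pred p ∷ es × Chain next (next (pred p)) es)
    chain-cons (nil p≡0)     p≢0 = contradiction p≡0 p≢0
    chain-cons (cons refl c) p≢0 = _ , refl , c

    node-step : ∀ {k s g S L rest rem} → Searching (g ∷ S) L rest rem k s →
                arrays s aStack (pred (regs s rHeight)) ≡ g → WP nodeBody s (Next k)
    node-step {k} {s} {g} {S} {L} {rest} {rem} q refl = final , more
      where
      open Searching q
      U = sumTo n (unvisited ∘ arrays s aLabel)
      A = sumTo n (List.length ∘ rem)
      p = arrays s aFirst g
      e = pred p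
      g-visited = Invariant.visited inv (here refl)
      g<n = proj₁ g-visited

      top popped advanced pushed : State
      top      = setReg rC p (setReg rA g (setReg rB (pred (regs s rHeight)) s))
      popped   = setReg rPending (pred (regs s rPending)) (setReg rHeight (pred (regs s rHeight))
                 (setReg rCount (suc (regs s rCount)) (setArray aOut (regs s rCount) g top)))
      w        = arrays s aSrc e
      advanced = setReg rB (arrays s aLabel w) (setReg rA w (setArray aFirst g (arrays s aNext e)
                 (setReg rD (arrays s aNext e) (setReg rC e top))))
      pushed   = setReg rPending (suc (regs s rPending)) (setReg rHeight (suc (regs s rHeight))
                 (setArray aStack (regs s rHeight) w (setArray aLabel w (regs s rLabel) advanced)))

      final : (p ≡ᵇ regs s rZero) ≡ true → Next k popped
      final t = measure S rest (arrays s aLabel) rem ,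
        subst (measure S rest (arrays s aLabel) rem <_) (sym k≡) (+-monoʳ-< (U + U) ≤-refl) ,
        _ , _ , _ , rem , record
        { fixed    = record { Fixed fixed }
        ; arcs     = record { Arcs arcs }
        ; inv      = finish tgt<n inv (chain-nil (chains g<n) (trans (≡ᵇ-true t) (Fixed.z≡ fixed)))
        ; chains   = chains
        ; rem-src  = rem-src
        ; stack    = proj₂ stack
        ; out      = Holds-push L count≡ out
        ; roots    = roots
        ; nodes    = nodes
        ; i≡       = i≡
        ; height≡  = cong pred height≡
        ; count≡   = cong suc count≡
        ; pending≡ = cong pred (trans pending≡ (+-suc _ _))
        ; k≡       = refl
        ; room     = subst (_≤ n) (cong (_+ U) (sym (+-suc (List.length S) _))) room
        ; labels   = labels
        }

      more : (p ≡ᵇ regs s rZero) ≡ false →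
             ((arrays s aLabel w ≡ᵇ regs s rZero) ≡ true → Next k pushed) ×
             ((arrays s aLabel w ≡ᵇ regs s rZero) ≡ false → Next k advanced)
      more t with chain-cons (chains g<n) (λ p≡0 → ≡ᵇ-false t (trans p≡0 (sym (Fixed.z≡ fixed))))
      ... | es , g-rem , chain = descend , ignore
        where
        e-arc = rem-src (subst (e ∈_) (sym g-rem) (here refl))
        e<m = proj₁ e-arc
        rem′ = rem [ g ↦ es ]
        first′ = arrays s aFirst [ g ↦ arrays s aNext e ]
        A≡ = shrink g<n g-rem
        at-g = update-same rem {g} {es} g refl
        w≡ = Arcs.src≡ arcs e<m

        chains′ : ∀ {x} → x < n → Chain (arrays s aNext) (first′ x) (rem′ x)
        chains′ {x} x<n with x ≟ g
        ... | yes refl = subst₂ (Chain (arrays s aNext)) (sym (update-same (arrays s aFirst) x refl)) (sym at-g) chain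
        ... | no ≢     = subst₂ (Chain (arrays s aNext)) (sym (update-other (arrays s aFirst) x ≢)) (sym (update-other rem x ≢)) (chains x<n)

        rem-src′ : ∀ {x f} → f ∈ rem′ x → f < m × src f ≡ x
        rem-src′ {x} {f} f∈ with x ≟ g
        ... | yes refl = rem-src (subst (f ∈_) (sym g-rem) (there (subst (f ∈_) at-g f∈)))
        ... | no ≢     = rem-src (subst (f ∈_) (update-other rem x ≢) f∈)

        descend : (arrays s aLabel w ≡ᵇ regs s rZero) ≡ true → Next k pushed
        descend t′ = measure (w ∷ g ∷ S) rest (arrays pushed aLabel) rem′ ,
          subst (measure (w ∷ g ∷ S) rest (arrays pushed aLabel) rem′ <_) (sym k≡)
            (fewer (List.length S) (List.length rest) U≡ A≡) ,
          _ , _ , _ , rem′ , record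
          { fixed    = record { Fixed fixed }
          ; arcs     = record { Arcs arcs }
          ; inv      = subst (λ w → Invariant (w ∷ g ∷ S) L rest (arrays s aLabel [ w ↦ regs s rLabel ]) rem′ (regs s rLabel)) (sym w≡)
                         (push tgt<n inv e<m (proj₂ e-arc) g-rem (subst (λ w → arrays s aLabel w ≡ 0) w≡ lab≡0) at-g (λ x → update-other rem x))
          ; chains   = chains′
          ; rem-src  = rem-src′
          ; stack    = Holds-push (g ∷ S) height≡ stack
          ; out      = out
          ; roots    = roots
          ; nodes    = nodes
          ; i≡       = i≡
          ; height≡  = cong suc height≡
          ; count≡   = count≡
          ; pending≡ = trans (cong suc pending≡) (sym (+-suc (List.length rest) _))
          ; k≡       = refl
          ; room     = subst (_≤ n) (trans (cong (suc (List.length S) + List.length L +_) U≡) (+-suc (suc (List.length S) + List.length L) _)) room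
          ; labels   = ≤-trans (+-monoʳ-≤ (regs s rLabel) (≤-trans (n≤1+n _) (≤-reflexive (sym U≡)))) labels
          }
          where
          lab≡0 = trans (≡ᵇ-true t′) (Fixed.z≡ fixed)
          U≡ = visit-unvisited (subst (_< n) (sym w≡) (tgt<n e<m)) lab≡0
                 (≤-trans (proj₁ (proj₂ g-visited)) (proj₂ (proj₂ g-visited)))
          identity : ∀ U A S R → suc (suc (U + U + (suc (suc S) + (A + R)))) ≡ suc U + suc U + (suc S + (suc A + R))
          identity = solve-∀
          fewer : ∀ {U U′ A A′} S R → U ≡ suc U′ → A ≡ suc A′ →
                  U′ + U′ + (suc (suc S) + (A′ + R)) < U + U + (suc S + (A + R))
          fewer {U′ = U′} {A′ = A′} S R refl refl = ≤-trans (n≤1+n _) (≤-reflexive (identity U′ A′ S R))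

        ignore : (arrays s aLabel w ≡ᵇ regs s rZero) ≡ false → Next k advanced
        ignore t′ = measure (g ∷ S) rest (arrays s aLabel) rem′ ,
          subst (measure (g ∷ S) rest (arrays s aLabel) rem′ <_) (sym k≡)
            (+-monoʳ-< (U + U) (+-monoʳ-< (suc (List.length S))
              (+-monoˡ-< (List.length rest) (≤-reflexive (sym A≡))))) ,
          _ , _ , _ , rem′ , record
          { fixed    = record { Fixed fixed }
          ; arcs     = record { Arcs arcs }
          ; inv      = skip-arc inv g-rem (subst (λ w → 1 ≤ arrays s aLabel w) w≡ (n≢0⇒n>0 λ w≡0 → ≡ᵇ-false t′ (trans w≡0 (sym (Fixed.z≡ fixed))))) at-g (λ x → update-other rem x)
          ; chains   = chains′
          ; rem-src  = rem-src′
          ; stack    = stack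
          ; out      = out
          ; roots    = roots
          ; nodes    = nodes
          ; i≡       = i≡
          ; height≡  = height≡
          ; count≡   = count≡
          ; pending≡ = pending≡
          ; k≡       = refl
          ; room     = room
          ; labels   = labels
          }

    search-step : ∀ {k s} → SomeSearch k s → test (rZero ≺ rPending) s ≡ true → WP searchBody s (Next k)
    search-step {s = s} ([] , L , [] , rem , q) t = contradiction (<ᵇ-true t)
      (λ z< → contradiction (subst₂ _<_ (Fixed.z≡ fixed) pending≡ z<) λ ())
      where open Searching q
    search-step {s = s} ([] , L , r ∷ rest , rem , q) t =
      (λ _ → root-step q (trans (cong (arrays s aOrder ∘ pred) i≡) (proj₁ roots))) ,
      (λ t → contradiction (trans height≡ (sym (Fixed.z≡ fixed))) (≡ᵇ-false t))
      where open Searching q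
    search-step {s = s} (g ∷ S , L , rest , rem , q) t =
      (λ t → contradiction (trans (sym height≡) (trans (≡ᵇ-true t) (Fixed.z≡ fixed))) λ ()) ,
      (λ _ → node-step q (trans (cong (arrays s aStack ∘ pred) height≡) (proj₁ stack)))
      where open Searching q

  module _ {order : List ℕ} where
    open Loop order
    open Search n m src tgt order using (initial)

    -- Both products of a search are kept: the first pass is run for its finishing order, the second
    -- for its labelling. The arcs come out reversed.
    Done : State → Set
    Done s = ∃[ L ] (Ready n m tgt src L s × FinishingOrder n m src tgt L ×
                     SearchLabelling n m src tgt order (arrays s aLabel) (regs s rLabel) × regs s rLabel ≤ n)

    list-start : ∀ {k s} → test (rI ≺ rN) s ≡ false → Resetting order k s →
                 Bucketing order m (setReg rI 0 s)
    list-start {s = s} t r = record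
      { fixed   = record { Fixed fixed }
      ; listing = record { Listing listing }
      ; copied  = copied ∘ in-range
      ; blank   = blank ∘ in-range
      ; left    = +-identityʳ m
      ; src-old = λ e<m _ → Arcs.src≡ arcs e<m
      ; tgt-old = λ e<m _ → Arcs.tgt≡ arcs e<m
      ; src-new = λ ()
      ; tgt-new = λ ()
      ; rem     = λ _ → []
      ; chains  = nil ∘ empty ∘ in-range
      ; rem-all = λ ()
      ; rem-src = λ ()
      ; total   = trans (sumTo-const n 0 (λ _ → refl)) (*-zeroʳ n)
      }
      where
      open Resetting r
      open Ready ready
      in-range : ∀ {i} → i < n → i < regs s rI
      in-range i<n = <-≤-trans i<n (subst (_≤ regs s rI) (Fixed.n≡ fixed) (<ᵇ-false t))

    search-start : ∀ {k s} → test (rI ≺ rM) s ≡ false → Bucketing order k s →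
      ∃[ j ] (j ≤ 4 * suc m × SomeSearch j (setReg rHeight 0 (setReg rLabel 0 (setReg rCount 0
        (setReg rPending (regs s rCount) (setReg rI (regs s rCount) s))))))
    search-start {k} {s} t r = measure [] order (arrays s aLabel) rem , bound ,
        _ , _ , _ , rem , record
      { fixed    = record { Fixed fixed }
      ; arcs     = record { src≡ = src-new ∘ in-range ; tgt≡ = tgt-new ∘ in-range }
      ; inv      = initial blank (rem-all ∘ in-range)
      ; chains   = chains
      ; rem-src  = λ e∈ → let e< , eq = rem-src e∈ in <-≤-trans e< 3≤m , eq
      ; stack    = tt
      ; out      = tt
      ; roots    = Holds-cong order (λ i< → copied (<-≤-trans i< short)) holds
      ; nodes    = nodes
      ; i≡       = count≡
      ; height≡  = refl
      ; count≡   = refl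
      ; pending≡ = trans count≡ (sym (+-identityʳ _))
      ; k≡       = refl
      ; room     = ≤-reflexive U≡n
      ; labels   = ≤-reflexive U≡n
      }
      where
      open Bucketing r
      open Listing listing
      open ≤-Reasoning
      U = sumTo n (unvisited ∘ arrays s aLabel)

      m≤3 : m ≤ regs s rI
      m≤3 = subst (_≤ regs s rI) (Fixed.m≡ fixed) (<ᵇ-false t)
      3≤m : regs s rI ≤ m
      3≤m = subst (regs s rI ≤_) left (m≤n+m _ k)
      in-range : ∀ {e} → e < m → e < regs s rI
      in-range e<m = <-≤-trans e<m m≤3

      U≡n : U ≡ n
      U≡n = trans (sumTo-const n 1 (cong unvisited ∘ blank)) (*-identityʳ n)

      -- Two units per unvisited node, one per edge and one per root: 2n + m + n, with n ≤ m + 1.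
      bound : measure [] order (arrays s aLabel) rem ≤ 4 * suc m
      bound = begin
        U + U + (sumTo n (List.length ∘ rem) + List.length order)    ≤⟨ +-mono-≤ (+-mono-≤ U≤ U≤) (+-mono-≤ (≤-trans (≤-reflexive total) (≤-trans 3≤m (n≤1+n m))) (≤-trans short n≤)) ⟩
        suc m + suc m + (suc m + suc m)                    ≡⟨ four (suc m) ⟩
        4 * suc m                                          ∎
        where
        U≤ = ≤-trans (≤-reflexive U≡n) n≤
        four : ∀ N → N + N + (N + N) ≡ 4 * N
        four = solve-∀

    search-end : (∀ {x} → x < n → x ∈ order) → ∀ {k s} → test (rZero ≺ rPending) s ≡ false →
                 SomeSearch k s → Done s
    search-end covers {s = s} t (S , L , rest , rem , q) = end S rest q
      where
      end : ∀ S rest {k} → Searching S L rest rem k s → Done s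
      end S rest q with subst₂ _≤_ (Searching.pending≡ q) (Fixed.z≡ (Searching.fixed q)) (<ᵇ-false t)
      end []      (_ ∷ _) q | ()
      end (_ ∷ S) (_ ∷ _) q | ()
      end (_ ∷ S) []      q | ()
      end []      []      q | _ = L , ready , order′ , searchLabelling n m src tgt src<n covers inv ,
                                  ≤-trans (m≤m+n _ _) labels
        where
        open Searching q
        order′ = finishingOrder n m src tgt src<n covers inv
        ready = record
          { fixed   = fixed
          ; arcs    = arcs
          ; listing = record
            { holds  = out
            ; count≡ = count≡
            ; short  = ≤-trans (m≤m+n _ _) room
            ; nodes  = FinishingOrder.nodes order′
            ; covers = FinishingOrder.covers order′
            }
          }

    pass-correct : ∀ {s} → Ready n m src tgt order s → Linear m passCost pass s Done
    pass-correct {s} ready =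
      linear-assign (linear-seq (linear-loop 1 (Resetting order) reset-step resetting n≤N)
      λ { s₁ (t₁ , _ , r₁) →
      linear-assign (linear-seq (linear-loop 1 (Bucketing order) list-step (list-start t₁ r₁) m≤N)
      λ { s₂ (t₂ , _ , r₂) → let j , j≤ , q = search-start t₂ r₂ in
      linear-assign (linear-assign (linear-assign (linear-assign (linear-assign
        (linear-map (λ { s₃ (t₃ , _ , r₃) → search-end (Listing.covers (Ready.listing ready)) t₃ r₃ })
          (linear-loop 4 SomeSearch search-step q j≤)))))) }) })
      where
      n≤N : n ≤ 1 * suc m
      n≤N = ≤-trans n≤ (≤-reflexive (sym (*-identityˡ _)))
      m≤N : m ≤ 1 * suc m
      m≤N = ≤-trans (n≤1+n m) (≤-reflexive (sym (*-identityˡ _)))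
      resetting : Resetting order n (setReg rI 0 s)
      resetting = record
        { ready  = record { fixed = record { Fixed (Ready.fixed ready) } ; arcs = record { Arcs (Ready.arcs ready) } ; listing = record { Listing (Ready.listing ready) } }
        ; left   = +-identityʳ n
        ; copied = λ ()
        ; blank  = λ ()
        ; empty  = λ ()
        }

-- Finding a central component

minBody maxBody suffixBody testBody advanceBody centreBody : Program

minBody =
  rA := aSrc at rI ︔ rA := aLabel at rA ︔ rB := aTgt at rI ︔ rB := aLabel at rB ︔
  rI := inc rI ︔ rC := aMin at rA ︔
  (if rA ≺ rB
   then (if rC ≐ rZero then aMin at rA ← rB else
          (if rB ≺ rC then aMin at rA ← rB else skip))
   else skip)

maxBody =
  rA := aSrc at rI ︔ rA := aLabel at rA ︔ rB := aTgt at rI ︔ rB := aLabel at rB ︔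
  rI := inc rI ︔ rC := aMax at rB ︔
  -- The initial 0 lies below every label and serves as the empty maximum, whereas `minBody` has to
  -- treat it apart.
  (if rA ≺ rB then (if rC ≺ rA then aMax at rB ← rA else skip) else skip)

suffixBody =
  -- Storing precedes the update, so the entry of a component covers only later components.
  aSuffix at rI ← rA ︔ rB := aMax at rI ︔ rI := dec rI ︔
  (if rB ≺ rA then rA := reg rB else skip)

testBody =
  rI := inc rI ︔ rB := aSuffix at rI ︔
  (if rI ≺ rA then skip else (if rB ≺ rI then skip else (rResult := const 1)))

advanceBody =
  rB := aMin at rI ︔
  -- A 0 means that no edge leaves the component; the value k + 1 then rules out every later
  -- candidate.
  (if rB ≐ rZero then rA := inc rLabel else (if rA ≺ rB then rA := reg rB else skip))

-- A component is tested before its own entry joins the maximum, which ranges over earlier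
-- components only.
centreBody = testBody ︔ advanceBody

sweep : Program
sweep =
  rI := const 0 ︔ (while rI ≺ rM loop minBody) ︔
  rI := const 0 ︔ (while rI ≺ rM loop maxBody) ︔
  rI := reg rLabel ︔ rA := reg rLabel ︔ (while rZero ≺ rI loop suffixBody) ︔
  rI := const 0 ︔ rA := const 0 ︔ (while rI ≺ rLabel loop centreBody)

sweepCost : ℕ
sweepCost = suc (suc (suc (cost minBody) * 1) + suc (suc (suc (cost maxBody) * 1) +
            (2 + (suc (suc (cost suffixBody) * 1) + (2 + suc (suc (cost centreBody) * 1))))))

module CentreScan (n m k : ℕ) (a b : ℕ → ℕ) where

  -- A minimum specified by its thresholds; `1 ≤ f j` tells a true entry from the empty one, 0. The
  -- parameter `m` is the number of edges treated so far.
  record Smallest (m : ℕ) (f : ℕ → ℕ) : Set where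
    field
      sound    : ∀ {j x} → 1 ≤ f j → f j ≤ x → Leaves m a b j x
      complete : ∀ {j x} → Leaves m a b j x → 1 ≤ f j × f j ≤ x

  record Largest (m : ℕ) (g : ℕ → ℕ) : Set where
    field
      sound    : ∀ {j x} → 1 ≤ x → x ≤ g j → Enters m a b j x
      complete : ∀ {j x} → Enters m a b j x → x ≤ g j

  module _ {e f} (small : Smallest e f) where
    open Smallest small

    smallest-keep : (a e < b e → 1 ≤ f (a e) × f (a e) ≤ b e) → Smallest (suc e) f
    smallest-keep keep = record
      { sound    = λ 1≤ ≤x → let e′ , e′< , more = sound 1≤ ≤x in e′ , m≤n⇒m≤1+n e′< , more
      ; complete = complete′ }
      where
      complete′ : ∀ {j x} → Leaves (suc e) a b j x → 1 ≤ f j × f j ≤ x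
      complete′ (e′ , e′< , refl , <b , b≤) with m≤n⇒m<n∨m≡n (≤-pred e′<)
      ... | inj₁ e′<e = complete (e′ , e′<e , refl , <b , b≤)
      ... | inj₂ refl = let 1≤ , ≤b = keep <b in 1≤ , ≤-trans ≤b b≤

    smallest-update : a e < b e → (∀ {x} → 1 ≤ f (a e) → f (a e) ≤ x → b e ≤ x) →
                      Smallest (suc e) (f [ a e ↦ b e ])
    smallest-update a<b lower = record { sound = sound′ ; complete = complete′ }
      where
      sound′ : ∀ {j x} → 1 ≤ (f [ a e ↦ b e ]) j → (f [ a e ↦ b e ]) j ≤ x → Leaves (suc e) a b j x
      sound′ {j} {x} 1≤ ≤x with j ≟ a e
      ... | yes refl = e , ≤-refl , refl , a<b , subst (_≤ x) (update-same f j refl) ≤x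
      ... | no ≢ = let e′ , e′< , more = sound (subst (1 ≤_) (update-other f j ≢) 1≤) (subst (_≤ x) (update-other f j ≢) ≤x) in
                   e′ , m≤n⇒m≤1+n e′< , more
      complete′ : ∀ {j x} → Leaves (suc e) a b j x → 1 ≤ (f [ a e ↦ b e ]) j × (f [ a e ↦ b e ]) j ≤ x
      complete′ {j} {x} l@(e′ , e′< , refl , <b , b≤) with j ≟ a e
      ... | yes eq = subst (λ y → 1 ≤ y × y ≤ x) (sym (update-same f j eq)) (≤-trans (s≤s z≤n) a<b , b≤x)
        where
        b≤x : b e ≤ x
        b≤x with m≤n⇒m<n∨m≡n (≤-pred e′<)
        ... | inj₂ refl = b≤
        ... | inj₁ e′<e = let 1≤ , ≤x = complete {a e} (e′ , e′<e , eq , subst (_< b e′) eq <b , b≤) in lower 1≤ ≤x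
      ... | no ≢ with m≤n⇒m<n∨m≡n (≤-pred e′<)
      ...   | inj₂ refl = contradiction refl ≢
      ...   | inj₁ e′<e = subst (λ y → 1 ≤ y × y ≤ x) (sym (update-other f j ≢)) (complete (e′ , e′<e , refl , <b , b≤))

  module _ {e g} (large : Largest e g) where
    open Largest large

    largest-keep : (a e < b e → a e ≤ g (b e)) → Largest (suc e) g
    largest-keep keep = record
      { sound    = λ 1≤ ≤g → let e′ , e′< , more = sound 1≤ ≤g in e′ , m≤n⇒m≤1+n e′< , more
      ; complete = complete′ }
      where
      complete′ : ∀ {j x} → Enters (suc e) a b j x → x ≤ g j
      complete′ (e′ , e′< , refl , a< , ≤a) with m≤n⇒m<n∨m≡n (≤-pred e′<)
      ... | inj₁ e′<e = complete (e′ , e′<e , refl , a< , ≤a)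
      ... | inj₂ refl = ≤-trans ≤a (keep a<)

    largest-update : a e < b e → g (b e) ≤ a e → Largest (suc e) (g [ b e ↦ a e ])
    largest-update a<b g≤a = record { sound = sound′ ; complete = complete′ }
      where
      sound′ : ∀ {j x} → 1 ≤ x → x ≤ (g [ b e ↦ a e ]) j → Enters (suc e) a b j x
      sound′ {j} {x} 1≤ x≤ with j ≟ b e
      ... | yes refl = e , ≤-refl , refl , a<b , subst (x ≤_) (update-same g j refl) x≤
      ... | no ≢ = let e′ , e′< , more = sound 1≤ (subst (x ≤_) (update-other g j ≢) x≤) in
                   e′ , m≤n⇒m≤1+n e′< , more
      complete′ : ∀ {j x} → Enters (suc e) a b j x → x ≤ (g [ b e ↦ a e ]) j
      complete′ {j} {x} (e′ , e′< , refl , a< , ≤a) with m≤n⇒m<n∨m≡n (≤-pred e′<)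
      ... | inj₂ refl = subst (x ≤_) (sym (update-same g (b e) refl)) ≤a
      ... | inj₁ e′<e with j ≟ b e
      ...   | yes eq = subst (x ≤_) (sym (update-same g j eq))
                         (≤-trans (subst (λ y → x ≤ g y) eq (complete (e′ , e′<e , refl , a< , ≤a))) g≤a)
      ...   | no ≢   = subst (x ≤_) (sym (update-other g j ≢)) (complete (e′ , e′<e , refl , a< , ≤a))

  record Labelled (s : State) : Set where
    field
      n≡   : regs s rN ≡ n
      m≡   : regs s rM ≡ m
      z≡   : regs s rZero ≡ 0
      k≡   : regs s rLabel ≡ k
      res≡ : regs s rResult ≡ 0
      a≡   : ∀ {e} → e < m → arrays s aLabel (arrays s aSrc e) ≡ a e
      b≡   : ∀ {e} → e < m → arrays s aLabel (arrays s aTgt e) ≡ b e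

  record Minimizing (j : ℕ) (s : State) : Set where
    field
      labelled : Labelled s
      left     : j + regs s rI ≡ m
      smallest : Smallest (regs s rI) (arrays s aMin)
      max≡     : ∀ x → arrays s aMax x ≡ 0

  record Maximizing (j : ℕ) (s : State) : Set where
    field
      labelled : Labelled s
      left     : j + regs s rI ≡ m
      smallest : Smallest m (arrays s aMin)
      largest  : Largest (regs s rI) (arrays s aMax)

  min-step : ∀ {j s} → Minimizing j s → test (rI ≺ rM) s ≡ true →
             WP minBody s (λ s′ → ∃[ j′ ] (j′ < j × Minimizing j′ s′))
  min-step {zero} {s} r t = contradiction (<ᵇ-true t) (<-irrefl (trans left (sym (Labelled.m≡ labelled))))
    where open Minimizing r
  min-step {suc j} {s} r t = body (a≡ i<m) (b≡ i<m)
    where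
    open Minimizing r
    open Labelled labelled
    i = regs s rI
    i<m : i < m
    i<m = subst (i <_) m≡ (<ᵇ-true t)

    loaded updated : ℕ → ℕ → State
    loaded x y = setReg rC (arrays s aMin x) (setReg rI (suc i) (setReg rB y (setReg rB (arrays s aTgt i)
                 (setReg rA x (setReg rA (arrays s aSrc i) s)))))
    updated x y = setArray aMin x y (loaded x y)

    Next : State → Set
    Next s′ = ∃[ j′ ] (j′ < suc j × Minimizing j′ s′)

    body : ∀ {x y} → x ≡ a i → y ≡ b i →
      ((x <ᵇ y) ≡ true →
        ((arrays s aMin x ≡ᵇ regs s rZero) ≡ true → Next (updated x y)) ×
        ((arrays s aMin x ≡ᵇ regs s rZero) ≡ false →
          ((y <ᵇ arrays s aMin x) ≡ true → Next (updated x y)) ×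
          ((y <ᵇ arrays s aMin x) ≡ false → Next (loaded x y)))) ×
      ((x <ᵇ y) ≡ false → Next (loaded x y))
    body refl refl =
      (λ a<b →
        (λ f≡0 → update (<ᵇ-true a<b) λ 1≤ _ → contradiction (subst (1 ≤_) (trans (≡ᵇ-true f≡0) z≡) 1≤) λ ()) ,
        (λ f≢0 →
          (λ b<f → update (<ᵇ-true a<b) λ _ → ≤-trans (<⇒≤ (<ᵇ-true b<f))) ,
          (λ f≤b → keep λ _ → n≢0⇒n>0 (λ f≡0 → ≡ᵇ-false f≢0 (trans f≡0 (sym z≡))) , <ᵇ-false f≤b))) ,
      (λ a≮b → keep λ a<b → contradiction (<ᵇ-false a≮b) (<⇒≱ a<b))
      where
      keep : (a i < b i → 1 ≤ arrays s aMin (a i) × arrays s aMin (a i) ≤ b i) → Next (loaded (a i) (b i))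
      keep h = j , ≤-refl , record
        { labelled = record { Labelled labelled } ; left = trans (+-suc j _) left
        ; smallest = smallest-keep smallest h ; max≡ = max≡ }
      update : a i < b i → (∀ {x} → 1 ≤ arrays s aMin (a i) → arrays s aMin (a i) ≤ x → b i ≤ x) →
               Next (updated (a i) (b i))
      update a<b h = j , ≤-refl , record
        { labelled = record { Labelled labelled } ; left = trans (+-suc j _) left
        ; smallest = smallest-update smallest a<b h ; max≡ = max≡ }

  max-step : ∀ {j s} → Maximizing j s → test (rI ≺ rM) s ≡ true →
             WP maxBody s (λ s′ → ∃[ j′ ] (j′ < j × Maximizing j′ s′))
  max-step {zero} {s} r t = contradiction (<ᵇ-true t) (<-irrefl (trans left (sym (Labelled.m≡ labelled))))
    where open Maximizing r
  max-step {suc j} {s} r t = body (a≡ i<m) (b≡ i<m)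
    where
    open Maximizing r
    open Labelled labelled
    i = regs s rI
    i<m : i < m
    i<m = subst (i <_) m≡ (<ᵇ-true t)

    loaded updated : ℕ → ℕ → State
    loaded x y = setReg rC (arrays s aMax y) (setReg rI (suc i) (setReg rB y (setReg rB (arrays s aTgt i)
                 (setReg rA x (setReg rA (arrays s aSrc i) s)))))
    updated x y = setArray aMax y x (loaded x y)

    Next : State → Set
    Next s′ = ∃[ j′ ] (j′ < suc j × Maximizing j′ s′)

    body : ∀ {x y} → x ≡ a i → y ≡ b i →
      ((x <ᵇ y) ≡ true →
        ((arrays s aMax y <ᵇ x) ≡ true → Next (updated x y)) ×
        ((arrays s aMax y <ᵇ x) ≡ false → Next (loaded x y))) ×
      ((x <ᵇ y) ≡ false → Next (loaded x y))
    body refl refl =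
      (λ a<b → (λ g<a → update (<ᵇ-true a<b) (<⇒≤ (<ᵇ-true g<a))) , (λ a≤g → keep λ _ → <ᵇ-false a≤g)) ,
      (λ a≮b → keep λ a<b → contradiction (<ᵇ-false a≮b) (<⇒≱ a<b))
      where
      keep : (a i < b i → a i ≤ arrays s aMax (b i)) → Next (loaded (a i) (b i))
      keep h = j , ≤-refl , record
        { labelled = record { Labelled labelled } ; left = trans (+-suc j _) left
        ; smallest = smallest ; largest = largest-keep largest h }
      update : a i < b i → arrays s aMax (b i) ≤ a i → Next (updated (a i) (b i))
      update a<b h = j , ≤-refl , record
        { labelled = record { Labelled labelled } ; left = trans (+-suc j _) left
        ; smallest = smallest ; largest = largest-update largest a<b h }

  -- v is the minimum of k and of g on i + 1, …, k.
  record Tail (g : ℕ → ℕ) (i v : ℕ) : Set where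
    field
      sound    : ∀ {x j} → x ≤ v → i < j → j ≤ k → x ≤ g j
      complete : ∀ {x} → x ≤ k → (∀ {j} → i < j → j ≤ k → x ≤ g j) → x ≤ v

  record Suffixing (j : ℕ) (s : State) : Set where
    field
      labelled : Labelled s
      i≡       : regs s rI ≡ j
      j≤k      : j ≤ k
      smallest : Smallest m (arrays s aMin)
      largest  : Largest m (arrays s aMax)
      current  : Tail (arrays s aMax) j (regs s rA)
      suffix   : ∀ {i} → j < i → i ≤ k → Tail (arrays s aMax) i (arrays s aSuffix i)

  suffix-step : ∀ {j s} → Suffixing j s → test (rZero ≺ rI) s ≡ true →
                WP suffixBody s (λ s′ → ∃[ j′ ] (j′ < j × Suffixing j′ s′))
  suffix-step {zero} r t = contradiction (subst₂ _<_ (Labelled.z≡ labelled) i≡ (<ᵇ-true t)) λ ()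
    where open Suffixing r
  suffix-step {suc j} {s} r t = body i≡
    where
    open Suffixing r
    g = arrays s aMax
    v = regs s rA

    loaded : ℕ → State
    loaded i = setReg rI (pred i) (setReg rB (g i) (setArray aSuffix i v s))

    Next : State → Set
    Next s′ = ∃[ j′ ] (j′ < suc j × Suffixing j′ s′)

    body : ∀ {i} → i ≡ suc j → ((g i <ᵇ v) ≡ true → Next (setReg rA (g i) (loaded i))) ×
                               ((g i <ᵇ v) ≡ false → Next (loaded i))
    body refl = (λ g<v → j , ≤-refl , record
                  { labelled = record { Labelled labelled } ; i≡ = refl ; j≤k = <⇒≤ j≤k
                  ; smallest = smallest ; largest = largest ; suffix = suffix′
                  ; current  = tail (<⇒≤ (<ᵇ-true g<v)) ≤-refl (λ _ x≤g → x≤g) }) ,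
                (λ v≤g → j , ≤-refl , record
                  { labelled = record { Labelled labelled } ; i≡ = refl ; j≤k = <⇒≤ j≤k
                  ; smallest = smallest ; largest = largest ; suffix = suffix′
                  ; current  = tail ≤-refl (<ᵇ-false v≤g) (λ x≤v _ → x≤v) })
      where
      suffix′ : ∀ {i} → j < i → i ≤ k → Tail g i ((arrays s aSuffix [ suc j ↦ v ]) i)
      suffix′ {i} j<i i≤k with i ≟ suc j
      ... | yes refl = subst (Tail g i) (sym (update-same (arrays s aSuffix) i refl)) current
      ... | no ≢     = subst (Tail g i) (sym (update-other (arrays s aSuffix) i ≢)) (suffix (≤∧≢⇒< j<i (≢ ∘ sym)) i≤k)


      tail : ∀ {v′} → v′ ≤ v → v′ ≤ g (suc j) → (∀ {x} → x ≤ v → x ≤ g (suc j) → x ≤ v′) → Tail g j v′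
      tail v′≤v v′≤g meet = record
        { sound    = λ x≤ j<i i≤k → case m≤n⇒m<n∨m≡n j<i of λ where
            (inj₁ j+1<i) → Tail.sound current (≤-trans x≤ v′≤v) j+1<i i≤k
            (inj₂ refl)  → ≤-trans x≤ v′≤g
        ; complete = λ x≤k h → meet (Tail.complete current x≤k (h ∘ <⇒≤)) (h ≤-refl j≤k)
        }

  -- v is the maximum of f on 1, …, i, where the value 0 stands for k + 1.
  record Head (f : ℕ → ℕ) (i v : ℕ) : Set where
    field
      sound    : ∀ {x j} → x ≤ k → v ≤ x → 1 ≤ j → j ≤ i → 1 ≤ f j × f j ≤ x
      complete : ∀ {x} → (∀ {j} → 1 ≤ j → j ≤ i → 1 ≤ f j × f j ≤ x) → v ≤ x

  Found : ℕ → ℕ → Set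
  Found i r = (r ≡ 1 × ∃[ c ] Central m a b k c) ⊎ (r ≡ 0 × (∀ {c} → c ≤ i → ¬ Central m a b k c))

  record Scanning (s : State) : Set where
    field
      n≡       : regs s rN ≡ n
      z≡       : regs s rZero ≡ 0
      k≡       : regs s rLabel ≡ k
      smallest : Smallest m (arrays s aMin)
      largest  : Largest m (arrays s aMax)
      suffix   : ∀ {i} → 1 ≤ i → i ≤ k → Tail (arrays s aMax) i (arrays s aSuffix i)

  record Centring (j : ℕ) (s : State) : Set where
    field
      scanning : Scanning s
      left     : j + regs s rI ≡ k
      head     : Head (arrays s aMin) (regs s rI) (regs s rA)
      found    : Found (regs s rI) (regs s rResult)

  record Tested (j : ℕ) (s : State) : Set where
    field
      scanning : Scanning s
      i        : ℕ
      i≡       : regs s rI ≡ suc i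
      left     : j + suc i ≡ k
      head     : Head (arrays s aMin) i (regs s rA)
      found    : Found (suc i) (regs s rResult)

  advance : ∀ {j s} → Tested j s → WP advanceBody s (λ s′ → ∃[ j′ ] (j′ < suc j × Centring j′ s′))
  advance {j} {s} r = body i≡
    where
    open Tested r
    open Scanning scanning
    f = arrays s aMin
    v = regs s rA

    Next : State → Set
    Next s′ = ∃[ j′ ] (j′ < suc j × Centring j′ s′)

    loaded : ℕ → State
    loaded x = setReg rB (f x) s

    body : ∀ {x} → x ≡ suc i →
      ((f x ≡ᵇ regs s rZero) ≡ true → Next (setReg rA (suc (regs s rLabel)) (loaded x))) ×
      ((f x ≡ᵇ regs s rZero) ≡ false →
        ((v <ᵇ f x) ≡ true → Next (setReg rA (f x) (loaded x))) ×
        ((v <ᵇ f x) ≡ false → Next (loaded x)))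
    body refl =
      (λ f≡0 → j , ≤-refl , record
        { scanning = record { Scanning scanning } ; left = left′ ; found = found′
        ; head = subst₂ (Head f) (sym i≡) (cong suc (sym k≡)) record
          { sound    = λ x≤k k<x → contradiction x≤k (<⇒≱ k<x)
          ; complete = λ h → contradiction (subst (1 ≤_) (trans (≡ᵇ-true f≡0) z≡) (proj₁ (h (s≤s z≤n) ≤-refl))) λ () } }) ,
      (λ f≢0 →
        (λ v<f → j , ≤-refl , record
          { scanning = record { Scanning scanning } ; left = left′ ; found = found′
          ; head = subst (λ i → Head f i (f (suc (Tested.i r)))) (sym i≡) (join f≢0 (<⇒≤ (<ᵇ-true v<f)) ≤-refl (λ _ f≤ → f≤)) }) ,
        (λ f≤v → j , ≤-refl , record
          { scanning = record { Scanning scanning } ; left = left′ ; found = found′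
          ; head = subst (λ i → Head f i v) (sym i≡) (join f≢0 ≤-refl (<ᵇ-false f≤v) (λ v≤ _ → v≤)) }))
      where
      left′ = subst (λ i → j + i ≡ k) (sym i≡) left
      found′ = subst (λ i → Found i (regs s rResult)) (sym i≡) found
      join : ∀ {v′} → (f (suc i) ≡ᵇ regs s rZero) ≡ false → v ≤ v′ → f (suc i) ≤ v′ →
             (∀ {x} → v ≤ x → f (suc i) ≤ x → v′ ≤ x) → Head f (suc i) v′
      join f≢0 v≤v′ f≤v′ least = record
        { sound    = λ x≤k v′≤x 1≤j j≤ → case m≤n⇒m<n∨m≡n j≤ of λ where
            (inj₁ j≤i)  → Head.sound head x≤k (≤-trans v≤v′ v′≤x) 1≤j (≤-pred j≤i)
            (inj₂ refl) → n≢0⇒n>0 (λ f≡0 → ≡ᵇ-false f≢0 (trans f≡0 (sym z≡))) , ≤-trans f≤v′ v′≤x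
        ; complete = λ h → least (Head.complete head (λ 1≤j j≤i → h 1≤j (m≤n⇒m≤1+n j≤i))) (proj₂ (h (s≤s z≤n) ≤-refl))
        }

  centre-step : ∀ {j s} → Centring j s → test (rI ≺ rLabel) s ≡ true →
                WP centreBody s (λ s′ → ∃[ j′ ] (j′ < j × Centring j′ s′))
  centre-step {zero} r t = contradiction (<ᵇ-true t) (<-irrefl (trans left (sym (Scanning.k≡ scanning))))
    where open Centring r
  centre-step {suc j} {s} r t =
    -- The candidate is central iff it is at least `rA` and at most its suffix value, hence two
    -- rejections and one acceptance.
    (λ i<v → advance (tested (reject λ c → <⇒≱ (<ᵇ-true i<v) (leaves-v c)))) ,
    (λ v≤i →
      (λ w<i → advance (tested (reject λ c → <⇒≱ (<ᵇ-true w<i) (enters-w c)))) ,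
      (λ i≤w → advance (tested-with (inj₁ (refl , suc i , accept (<ᵇ-false v≤i) (<ᵇ-false i≤w))))))
    where
    open Centring r
    open Scanning scanning
    i = regs s rI

    i<k : suc i ≤ k
    i<k = subst (i <_) k≡ (<ᵇ-true t)

    loaded : State
    loaded = setReg rB (arrays s aSuffix (suc i)) (setReg rI (suc i) s)

    leaves-v : Central m a b k (suc i) → regs s rA ≤ suc i
    leaves-v c = Head.complete head λ 1≤j j≤i → Smallest.complete smallest (Central.leaves c 1≤j (s≤s j≤i))

    enters-w : Central m a b k (suc i) → suc i ≤ arrays s aSuffix (suc i)
    enters-w c = Tail.complete (suffix (s≤s z≤n) i<k) i<k λ i<j j≤k → Largest.complete largest (Central.enters c i<j j≤k)

    accept : regs s rA ≤ suc i → suc i ≤ arrays s aSuffix (suc i) → Central m a b k (suc i)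
    accept v≤ ≤w = central (s≤s z≤n) i<k
      (λ 1≤j j<i → let 1≤f , f≤ = Head.sound head i<k v≤ 1≤j (≤-pred j<i) in Smallest.sound smallest 1≤f f≤)
      (λ i<j j≤k → Largest.sound largest (s≤s z≤n) (Tail.sound (suffix (s≤s z≤n) i<k) ≤w i<j j≤k))

    reject : ¬ Central m a b k (suc i) → Found (suc i) (regs s rResult)
    reject ¬c with found
    ... | inj₁ yes′ = inj₁ yes′
    ... | inj₂ (r≡0 , none) = inj₂ (r≡0 , λ {c} c≤ → case m≤n⇒m<n∨m≡n c≤ of λ where
      (inj₁ c≤i)  → none (≤-pred c≤i)
      (inj₂ refl) → ¬c)

    tested : Found (suc i) (regs s rResult) → Tested j loaded
    tested found′ = record
      { scanning = record { Scanning scanning } ; i = i ; i≡ = refl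
      ; left = trans (+-suc j i) left ; head = head ; found = found′ }

    tested-with : Found (suc i) 1 → Tested j (setReg rResult 1 loaded)
    tested-with found′ = record
      { scanning = record { Scanning scanning } ; i = i ; i≡ = refl
      ; left = trans (+-suc j i) left ; head = head ; found = found′ }

linear-then : ∀ {m c b p q s Q} → test b s ≡ true → Linear m c p s Q → Linear m (suc c) (if b then p else q) s Q
linear-then eq (linear (s′ , t , d , t≤ , x)) = linear (s′ , suc t , ⇓then eq d , +-mono-≤ (s≤s z≤n) t≤ , x)

linear-else : ∀ {m c b p q s Q} → test b s ≡ false → Linear m c q s Q → Linear m (suc c) (if b then p else q) s Q
linear-else eq (linear (s′ , t , d , t≤ , x)) = linear (s′ , suc t , ⇓else eq d , +-mono-≤ (s≤s z≤n) t≤ , x)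

module _ (n m k : ℕ) (k≤ : k ≤ suc m) (a b : ℕ → ℕ) where
  open CentreScan n m k a b

  Swept : State → Set
  Swept s = regs s rN ≡ n × regs s rZero ≡ 0 × Found k (regs s rResult)

  sweep-correct : ∀ {s} → Labelled s → (∀ x → arrays s aMin x ≡ 0) → (∀ x → arrays s aMax x ≡ 0) →
                  Linear m sweepCost sweep s Swept
  sweep-correct {s} labelling min≡0 max≡0 =
    linear-assign (linear-seq (linear-loop 1 Minimizing min-step minimizing m≤N)
    λ { s₁ (t₁ , _ , r₁) →
    linear-assign (linear-seq (linear-loop 1 Maximizing max-step (maximizing t₁ r₁) m≤N)
    λ { s₂ (t₂ , _ , r₂) →
    linear-assign (linear-assign (linear-seq (linear-loop 1 Suffixing suffix-step (suffixing t₂ r₂) k≤N)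
    λ { s₃ (t₃ , _ , r₃) →
    linear-assign (linear-assign (linear-map (λ { s₄ (t₄ , _ , r₄) → swept t₄ r₄ })
      (linear-loop 1 Centring centre-step (centring t₃ r₃) k≤N))) })) }) })
    where
    m≤N : m ≤ 1 * suc m
    m≤N = ≤-trans (n≤1+n m) (≤-reflexive (sym (*-identityˡ _)))
    k≤N : k ≤ 1 * suc m
    k≤N = ≤-trans k≤ (≤-reflexive (sym (*-identityˡ _)))

    minimizing : Minimizing m (setReg rI 0 s)
    minimizing = record
      { labelled = record { Labelled labelling } ; left = +-identityʳ m ; max≡ = max≡0
      ; smallest = record { sound = λ {j} 1≤ _ → contradiction (subst (1 ≤_) (min≡0 j) 1≤) λ () ; complete = λ () } }

    at-end : ∀ {j i i′ l} → j + i ≡ l → i′ ≡ l → i′ ≤ i → i ≡ l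
    at-end {j} left refl ≥ = ≤-antisym (subst (_ ≤_) left (m≤n+m _ j)) ≥

    maximizing : ∀ {j s} → test (rI ≺ rM) s ≡ false → Minimizing j s → Maximizing m (setReg rI 0 s)
    maximizing {s = s} t r = record
      { labelled = record { Labelled labelled } ; left = +-identityʳ m
      ; smallest = subst (λ i → Smallest i (arrays s aMin)) (at-end left (Labelled.m≡ labelled) (<ᵇ-false t)) smallest
      ; largest  = record { sound = λ {j} 1≤x x≤ → contradiction (≤-trans 1≤x (subst (_ ≤_) (max≡ j) x≤)) λ () ; complete = λ () } }
      where open Minimizing r

    suffixing : ∀ {j s} → test (rI ≺ rM) s ≡ false → Maximizing j s →
                Suffixing k (setReg rA (regs s rLabel) (setReg rI (regs s rLabel) s))
    suffixing {s = s} t r = record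
      { labelled = record { Labelled labelled } ; i≡ = Labelled.k≡ labelled ; j≤k = ≤-refl
      ; smallest = smallest
      ; largest  = subst (λ i → Largest i (arrays s aMax)) (at-end left (Labelled.m≡ labelled) (<ᵇ-false t)) largest
      ; current  = subst (Tail (arrays s aMax) k) (sym (Labelled.k≡ labelled)) record
          { sound = λ _ k<j j≤k → contradiction j≤k (<⇒≱ k<j) ; complete = λ x≤k _ → x≤k }
      ; suffix   = λ k<i i≤k → contradiction i≤k (<⇒≱ k<i) }
      where open Maximizing r

    centring : ∀ {j s} → test (rZero ≺ rI) s ≡ false → Suffixing j s →
               Centring k (setReg rA 0 (setReg rI 0 s))
    centring {j} {s} t r = record
      { scanning = record { n≡ = n≡ ; z≡ = z≡ ; k≡ = k≡ ; smallest = smallest ; largest = largest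
                          ; suffix = λ 1≤i i≤k → suffix (≤-trans (s≤s (subst₂ _≤_ i≡ z≡ (<ᵇ-false t))) 1≤i) i≤k }
      ; left  = +-identityʳ k
      ; head  = record { sound = λ _ _ 1≤j j≤0 → contradiction (≤-trans 1≤j j≤0) λ () ; complete = λ _ → z≤n }
      ; found = inj₂ (res≡ , λ c≤0 c → contradiction (≤-trans (Central.1≤i c) c≤0) λ ()) }
      where
      open Suffixing r
      open Labelled labelled

    swept : ∀ {j s} → test (rI ≺ rLabel) s ≡ false → Centring j s → Swept s
    swept {s = s} t r = n≡ , z≡ , subst (λ i → Found i (regs s rResult)) (at-end left k≡ (<ᵇ-false t)) found
      where
      open Centring r
      open Scanning scanning

-- The complete algorithm

main search : Program

main =
  rI := const 0 ︔ (while rI ≺ rN loop fillBody) ︔ rCount := reg rN ︔ pass ︔ pass ︔ sweep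

-- With n > m + 1 nodes there is no centre, and no time to visit them all.
search = rA := inc rM ︔ (if rA ≺ rN then skip else main)

mainCost searchCost : ℕ
mainCost   = suc (suc (suc (cost fillBody) * 1) + suc (passCost + (passCost + sweepCost)))
searchCost = 2 + mainCost

module _ (n m : ℕ) (src tgt : ℕ → ℕ) where

  Comparable : Set
  Comparable = ∃[ c ] (c < n × (∀ {v} → v < n → v ≢ c →
    Star (Arc m src tgt) c v ⊎ Star (Arc m src tgt) v c))

  Outcome : State → Set
  Outcome s = regs s rN ≡ n × regs s rZero ≡ 0 ×
    ((regs s rResult ≡ 1 × Comparable) ⊎ (regs s rResult ≡ 0 × ¬ Comparable))

module _ {n m : ℕ} {src tgt : ℕ → ℕ}
  (src<n : ∀ {e} → e < m → src e < n) (tgt<n : ∀ {e} → e < m → tgt e < n) where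

  record Filling (k : ℕ) (s : State) : Set where
    field
      fixed   : Fixed n m s
      arcs    : Arcs m src tgt s
      left    : k + regs s rI ≡ n
      list    : List ℕ
      length≡ : List.length list ≡ regs s rI
      holds   : Holds (arrays s aOut) list
      nodes   : ∀ {x} → x ∈ list → x < regs s rI
      covers  : ∀ {x} → x < regs s rI → x ∈ list

  fill-step : ∀ {k s} → Filling k s → test (rI ≺ rN) s ≡ true →
              WP fillBody s (λ s′ → ∃[ k′ ] (k′ < k × Filling k′ s′))
  fill-step {zero} r t = contradiction (<ᵇ-true t) (<-irrefl (trans left (sym (Fixed.n≡ fixed))))
    where open Filling r
  fill-step {suc k} {s} r t = k , ≤-refl , record
    { fixed   = record { Fixed fixed }
    ; arcs    = record { Arcs arcs }
    ; left    = trans (+-suc k _) left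
    ; list    = regs s rI ∷ list
    ; length≡ = cong suc length≡
    ; holds   = Holds-push list (sym length≡) holds
    ; nodes   = λ { (here refl) → ≤-refl ; (there x∈) → m≤n⇒m≤1+n (nodes x∈) }
    ; covers  = λ {x} x< → case x ≟ regs s rI of λ where
        (yes refl) → here refl
        (no ≢)     → there (covers (≤∧≢⇒< (≤-pred x<) ≢))
    }
    where open Filling r

  module _ (n≤ : n ≤ suc m) where

    filled : ∀ {k s} → test (rI ≺ rN) s ≡ false → Filling k s →
             ∃[ order ] Ready n m src tgt order (setReg rCount (regs s rN) s)
    filled {k} {s} t r = list , record
      { fixed   = record { Fixed fixed }
      ; arcs    = record { Arcs arcs }
      ; listing = record
        { holds  = holds
        ; count≡ = trans (Fixed.n≡ fixed) (sym (trans length≡ i≡n))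
        ; short  = ≤-reflexive (trans length≡ i≡n)
        ; nodes  = subst (_ <_) i≡n ∘ nodes
        ; covers = covers ∘ subst (_ <_) (sym i≡n)
        }
      }
      where
      open Filling r
      i≡n : regs s rI ≡ n
      i≡n = ≤-antisym (subst (_ ≤_) left (m≤n+m _ k)) (subst (_≤ regs s rI) (Fixed.n≡ fixed) (<ᵇ-false t))

    module _ {L} (finishing : FinishingOrder n m src tgt L) where

      after-passes : ∀ {s} → Pass.Done n m n≤ tgt src tgt<n src<n {L} s → Linear m sweepCost sweep s (Outcome n m src tgt)
      after-passes {s} (_ , ready , _ , labelling , k≤n) =
        linear-map (λ { s′ (n≡ , z≡ , found) → n≡ , z≡ , outcome found })
          (sweep-correct n m k (≤-trans k≤n n≤) a b labelled (Fixed.min≡ fixed) (Fixed.max≡ fixed))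
        where
        k = regs s rLabel
        open Components src<n tgt<n finishing labelling
        open Ready ready
        open CentreScan n m k a b

        labelled : Labelled s
        labelled = record
          { Fixed fixed
          ; k≡ = refl
          ; a≡ = cong (arrays s aLabel) ∘ Arcs.src≡ arcs
          ; b≡ = cong (arrays s aLabel) ∘ Arcs.tgt≡ arcs
          }

        outcome : ∀ {r} → Found k r → (r ≡ 1 × Comparable n m src tgt) ⊎ (r ≡ 0 × ¬ Comparable n m src tgt)
        outcome (inj₁ (r≡1 , i , good)) with c , c<n , h ← central-node good = inj₁ (r≡1 , c , c<n , λ v<n _ → h v<n)
        outcome (inj₂ (r≡0 , none)) = inj₂ (r≡0 , λ { (c , c<n , h) →
          let good = comparable⇒central c<n h in none (Central.i≤k good) good })

    main-correct : ∀ {s} → Fixed n m s → Arcs m src tgt s →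
      Linear m mainCost main s (Outcome n m src tgt)
    main-correct {s} fixed arcs =
      linear-assign (linear-seq (linear-loop 1 Filling fill-step filling n≤N)
      λ { s₁ (t₁ , _ , r₁) → let order , ready = filled t₁ r₁ in
      linear-assign (linear-seq (Pass.pass-correct n m n≤ src tgt src<n tgt<n ready)
      λ { s₂ (L , ready′ , finishing , _) →
      linear-seq (Pass.pass-correct n m n≤ tgt src tgt<n src<n ready′) λ s₃ → after-passes finishing }) })
      where
      n≤N : n ≤ 1 * suc m
      n≤N = ≤-trans n≤ (≤-reflexive (sym (*-identityˡ _)))
      filling : Filling n (setReg rI 0 s)
      filling = record
        { fixed = record { Fixed fixed } ; arcs = record { Arcs arcs } ; left = +-identityʳ n
        ; list = [] ; length≡ = refl ; holds = tt ; nodes = λ () ; covers = λ () }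

  search-correct : (Comparable n m src tgt → n ≤ suc m) → ∀ {s} → Fixed n m s → Arcs m src tgt s →
                   Linear m searchCost search s (Outcome n m src tgt)
  search-correct bound {s} fixed arcs = linear-assign (go refl)
    where
    open Fixed fixed

    go : ∀ {r} → (suc (regs s rM) <ᵇ regs s rN) ≡ r →
         Linear m (suc mainCost) (if rA ≺ rN then skip else main) (setReg rA (suc (regs s rM)) s) (Outcome n m src tgt)
    -- `rResult` still has its initial value 0, which is the negative answer.
    go {true}  t = linear-then t (linear (_ , 1 , ⇓skip , s≤s z≤n , n≡ , z≡ ,
      inj₂ (res≡ , λ comparable → <⇒≱ (subst₂ _<_ (cong suc m≡) n≡ (<ᵇ-true t)) (bound comparable))))
    go {false} t = linear-else t (main-correct (subst₂ (λ n m → n ≤ suc m) n≡ m≡ (<ᵇ-false t))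
      record { Fixed fixed } record { Arcs arcs })

-- Distances

module _ {A : Set} {R : A → A → Set} where

  length-◅◅ : ∀ {x y z} (p : Star R x y) (q : Star R y z) → length (p ◅◅ q) ≡ length p + length q
  length-◅◅ ε       q = refl
  length-◅◅ (_ ◅ p) q = cong suc (length-◅◅ p q)

  unsnoc : ∀ {x y d} (p : Star R x y) → length p ≡ suc d →
           ∃[ z ] ((∃[ q ] (length {R = R} {x} {z} q ≡ d)) × R z y)
  unsnoc (r ◅ ε)        refl = _ , (ε , refl) , r
  unsnoc (r ◅ q@(_ ◅ _)) refl with z , (q′ , eq) , r′ ← unsnoc q refl = z , (r ◅ q′ , cong suc eq) , r′

module _ {n : ℕ} (G : Digraph n) where

  -- Finiteness of `distance` decides reachability, which makes the choice in `charge` constructive.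
  reaches? : ∀ u v → Dec (Reaches G u v)
  reaches? u v with distance G u v
  ... | [ d ] , (p , _) , _ = yes p
  ... | ⊤⁺    , none        = no λ p → none (length p) (p , refl)

  module _ {c : Fin n} (comparable : ∀ v → v ≢ c → Reaches G c v ⊎ Reaches G v c) where

    -- An edge charged to v: the last one of a path from c, or else the first one of a path to c.
    data Charged (v : Fin n) : Fin (suc (#edges G)) → Set where
      itself : v ≡ c → Charged v zero
      into   : ∀ {u i} → Reaches G c u → (u , v) ≡ List.lookup (edges G) i → Charged v (suc i)
      out-of : ∀ {w i} → ¬ Reaches G c v → (v , w) ≡ List.lookup (edges G) i → Charged v (suc i)

    charge : ∀ v → ∃[ i ] Charged v i
    charge v with v Fin.≟ c
    ... | yes v≡c = zero , itself v≡c
    ... | no  v≢c with reaches? c v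
    ...   | yes ε = contradiction refl v≢c
    ...   | yes p@(_ ◅ _) with u , (q , _) , e ← unsnoc p refl = suc (Any.index e) , into q (lookup-index e)
    ...   | no ¬p with comparable v v≢c
    ...     | inj₁ p       = contradiction p ¬p
    ...     | inj₂ ε       = contradiction refl v≢c
    ...     | inj₂ (e ◅ _) = suc (Any.index e) , out-of ¬p (lookup-index e)

    -- Edges charged in the same manner are charged to the same end. In the mixed cases the tail of
    -- the edge would be reached from `c`, by `into`, and unreachable from `c`, by `out-of`.
    charged-once : ∀ {v v′ i} → Charged v i → Charged v′ i → v ≡ v′
    charged-once (itself refl) (itself refl) = refl
    charged-once (into _ e) (into _ e′) = cong proj₂ (trans e (sym e′))
    charged-once (out-of _ e) (out-of _ e′) = cong proj₁ (trans e (sym e′))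
    charged-once (into p e) (out-of ¬p e′) with refl ← trans e (sym e′) = contradiction p ¬p
    charged-once (out-of ¬p e) (into p e′) with refl ← trans e (sym e′) = contradiction p ¬p

    n≤1+#edges : n ≤ suc (#edges G)
    n≤1+#edges = Fin.injective⇒≤ {f = proj₁ ∘ charge} λ {v} {v′} eq →
      charged-once (proj₂ (charge v)) (subst (Charged v′) (sym eq) (proj₂ (charge v′)))

  IsDistance-unique : ∀ {u v d d′} → IsDistance G u v [ d ] → IsDistance G u v [ d′ ] → d ≡ d′
  IsDistance-unique (p , least) (p′ , least′) = ≤-antisym (least _ p′) (least′ _ p)

  -- Drop the last edge of a shortest walk: a shorter walk to the node before it would extend to a
  -- shorter walk to `v`.
  IsDistance-pred : ∀ {u v d} → IsDistance G u v [ suc d ] → ∃[ w ] IsDistance G u w [ d ]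
  IsDistance-pred ((p , len) , least) with w , q , e ← unsnoc p len =
    w , q , λ { k (r , refl) → ≤-pred (≤-trans (least _ (r ◅◅ (e ◅ ε) , refl))
      (≤-reflexive (trans (length-◅◅ r (e ◅ ε)) (+-comm _ 1)))) }

  IsDistance-below : ∀ {u v d} i → i ≤ d → IsDistance G u v [ d ] → ∃[ w ] IsDistance G u w [ i ]
  IsDistance-below {d = zero}  zero z≤n is = _ , is
  IsDistance-below {d = suc d} i    i≤  is with m≤n⇒m<n∨m≡n i≤
  ... | inj₂ refl = _ , is
  ... | inj₁ i<   = IsDistance-below i (≤-pred i<) (proj₂ (IsDistance-pred is))

  -- Nodes at the distances 0, …, d are distinct.
  distance<n : ∀ {u v d} → IsDistance G u v [ d ] → d < n
  distance<n {u} {v} {d} is = Fin.injective⇒≤ {f = proj₁ ∘ node} λ {i} {j} eq →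
    Fin.toℕ-injective (IsDistance-unique
      {u} {proj₁ (node j)} {toℕ i} {toℕ j}
      (subst (λ w → IsDistance G u w [ toℕ i ]) eq (proj₂ (node i))) (proj₂ (node j)))
    where
    node : ∀ (i : Fin (suc d)) → ∃[ w ] IsDistance G u w [ toℕ i ]
    node i = IsDistance-below (toℕ i) (≤-pred (Fin.toℕ<n i)) is

  dist≤ : ∀ {u v} → Reaches G u v → dist G u v ≤⁺ [ pred n ]
  dist≤ {u} {v} p with distance G u v
  ... | [ d ] , is   = [ <⇒≤pred (distance<n is) ]
  ... | ⊤⁺    , none = contradiction (p , refl) (none (length p))

  dist-finite : ∀ {u v k} → dist G u v ≤⁺ [ k ] → Reaches G u v
  dist-finite {u} {v} d≤ with distance G u v | d≤
  ... | [ d ] , (p , _) , _ | _  = p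
  ... | ⊤⁺    , _           | ()

  1≤dist : ∀ {u v} → u ≢ v → [ 1 ] ≤⁺ dist G u v
  1≤dist {u} {v} u≢v with distance G u v
  ... | [ zero ]  , (ε , _) , _ = contradiction refl u≢v
  ... | [ suc d ] , _           = [ s≤s z≤n ]
  ... | ⊤⁺        , _           = _ ≤⊤⁺

  1≤minDist : ∀ {u v} → u ≢ v → [ 1 ] ≤⁺ dist G u v ⊓∞ dist G v u
  1≤minDist {u} {v} u≢v =
    ⊓∞-glb {[ 1 ]} {dist G u v} {dist G v u} (1≤dist u≢v) (1≤dist (u≢v ∘ sym))

  minDist≤eccentricity : ∀ c v → dist G c v ⊓∞ dist G v c ≤⁺ minEccentricity G c
  minDist≤eccentricity c v = All.lookup
    (xs≤max [ 0 ] (List.map (λ v → dist G c v ⊓∞ dist G v c) (allFin n)))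
    (∈-map⁺ (λ v → dist G c v ⊓∞ dist G v c) (∈-allFin v))

  centre⇒radius≤ : HasCentre G → minRadius G ≤⁺ [ pred n ]
  centre⇒radius≤ (c , comparable) = ≤∞-trans {minRadius G} {minEccentricity G c} {[ pred n ]}
    (All.lookup (min≤xs ⊤⁺ (List.map (minEccentricity G) (allFin n))) (∈-map⁺ (minEccentricity G) (∈-allFin c)))
    (max≤v⁺ {v = [ pred n ]} {⊥ = [ 0 ]} {xs = List.map (λ v → dist G c v ⊓∞ dist G v c) (allFin n)} [ z≤n ] (All.map⁺ (All.tabulate λ {v} _ → minDist≤ v)))
    where
    minDist≤ : ∀ v → dist G c v ⊓∞ dist G v c ≤⁺ [ pred n ]
    minDist≤ v with v Fin.≟ c
    ... | yes refl = ≤∞-trans (⊓∞-≤ˡ (dist G c c) (dist G c c)) (dist≤ ε)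
    ... | no v≢c with comparable v v≢c
    ...   | inj₁ p = ≤∞-trans (⊓∞-≤ˡ (dist G c v) (dist G v c)) (dist≤ p)
    ...   | inj₂ p = ≤∞-trans (⊓∞-≤ʳ (dist G c v) (dist G v c)) (dist≤ p)

  -- A finite minimum is attained at some `c`. For each `v` the smaller of the two distances between
  -- `c` and `v` is then finite, and it equals one of them.
  radius-finite⇒centre : ∀ {k} → minRadius G ≤⁺ [ k ] → HasCentre G
  radius-finite⇒centre {k} r≤ with argmin-sel id ⊤⁺ (List.map (minEccentricity G) (allFin n))
  ... | inj₁ eq with () ← subst (_≤⁺ [ k ]) eq r≤
  ... | inj₂ r∈ with c , _ , eq ← ∈-map⁻ (minEccentricity G) r∈ = c , λ v _ → comparable v
    where
    comparable : ∀ v → Reaches G c v ⊎ Reaches G v c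
    comparable v with ⊓∞-sel (dist G c v) (dist G v c)
      | ≤∞-trans (minDist≤eccentricity c v) (subst (_≤⁺ [ k ]) eq r≤)
    ... | inj₁ eq′ | d≤ = inj₁ (dist-finite (subst (_≤⁺ [ k ]) eq′ d≤))
    ... | inj₂ eq′ | d≤ = inj₂ (dist-finite (subst (_≤⁺ [ k ]) eq′ d≤))

  1≤radius : (∀ c → ∃[ v ] v ≢ c) → [ 1 ] ≤⁺ minRadius G
  1≤radius other = v≤min⁺ {⊤ = ⊤⁺} {xs = List.map (minEccentricity G) (allFin n)} (_ ≤⊤⁺)
    (All.map⁺ (All.tabulate λ {c} _ → 1≤eccentricity c))
    where
    1≤eccentricity : ∀ c → [ 1 ] ≤⁺ minEccentricity G c
    1≤eccentricity c with v , v≢c ← other c =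
      ≤∞-trans {[ 1 ]} {dist G c v ⊓∞ dist G v c} {minEccentricity G c}
        (1≤minDist (v≢c ∘ sym)) (minDist≤eccentricity c v)

-- Approximation from the existence of a centre

another : ∀ {n} (c : Fin (suc (suc n))) → ∃[ v ] v ≢ c
another zero    = suc zero , λ ()
another (suc _) = zero , λ ()

·-mono : ∀ α {R} → [ 1 ] ≤⁺ R → [ α ] ≤⁺ (α · R)
·-mono α {[ r ]} [ 1≤r ] = [ ≤-trans (≤-reflexive (sym (*-identityʳ α))) (*-monoʳ-≤ α 1≤r) ]
·-mono α {⊤⁺}    _       = _ ≤⊤⁺

0≤ : ∀ R → [ 0 ] ≤⁺ R
0≤ [ r ] = [ z≤n ]
0≤ ⊤⁺    = _ ≤⊤⁺

-- The radius is ∞, and so is the output. This includes n = 0, where the upper bound reads ∞ ≤ 0 · ∞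
-- = ∞.
no-centre-approximation : ∀ {n} (G : Digraph n) → ¬ HasCentre G → ApproximatesMinRadius #nodes G 0
no-centre-approximation {n} G none with minRadius G | radius-finite⇒centre G
... | [ r ] | finite = contradiction (finite ≤∞-refl) none
... | ⊤⁺    | _      = ≤∞-refl , ≤∞-refl

-- The output is `n`, coded as n + 1. For n = 1 it would be wrong, since R = 0 forces the output 0.
centre-approximation : ∀ {n} (G : Digraph n) → n ≢ 1 → HasCentre G → ApproximatesMinRadius #nodes G (suc n)
centre-approximation {zero}        G _   (() , _)
centre-approximation {suc zero}    G n≢1 _      = contradiction refl n≢1
centre-approximation {suc (suc n)} G _   centre =
  ≤∞-trans (centre⇒radius≤ G centre) [ n≤1+n _ ] , ·-mono (suc (suc n)) (1≤radius G another)

singleton-approximation : (G : Digraph 1) → HasCentre G → ApproximatesMinRadius #nodes G 1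
singleton-approximation G centre = centre⇒radius≤ G centre , 0≤ _

-- Digraphs as numbered arcs

fromList-lookup : ∀ {A : Set} (f : A → ℕ) xs {e} (e< : e < List.length xs) →
                  fromList (List.map f xs) e ≡ f (List.lookup xs (fromℕ< e<))
fromList-lookup f (x ∷ xs) {zero}  (s≤s _)  = refl
fromList-lookup f (x ∷ xs) {suc e} (s≤s e<) = fromList-lookup f xs e<

module _ {n : ℕ} (G : Digraph n) where

  tail head : ℕ → ℕ
  tail = arrays (input G) aSrc
  head = arrays (input G) aTgt

  edge : ∀ {e} → e < #edges G → Fin n × Fin n
  edge e< = List.lookup (edges G) (fromℕ< e<)

  tail≡ : ∀ {e} (e< : e < #edges G) → tail e ≡ toℕ (proj₁ (edge e<))
  tail≡ = fromList-lookup (toℕ ∘ proj₁) (edges G)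

  head≡ : ∀ {e} (e< : e < #edges G) → head e ≡ toℕ (proj₂ (edge e<))
  head≡ = fromList-lookup (toℕ ∘ proj₂) (edges G)

  E _↝_ : ℕ → ℕ → Set
  E   = Arc (#edges G) tail head
  _↝_ = Star E

  Edge⇒E : ∀ {u v} → Edge G u v → E (toℕ u) (toℕ v)
  Edge⇒E {u} {v} uv = toℕ i , Fin.toℕ<n i , at-i tail≡ , at-i head≡
    where
    i = Any.index uv
    at-i : ∀ {f : ℕ → ℕ} {g : Fin n × Fin n → Fin n} →
           (∀ {e} (e< : e < #edges G) → f e ≡ toℕ (g (edge e<))) → f (toℕ i) ≡ toℕ (g (u , v))
    at-i {g = g} f≡ = trans (f≡ (Fin.toℕ<n i)) (cong (toℕ ∘ g) (trans
      (cong (List.lookup (edges G)) (Fin.fromℕ<-toℕ i (Fin.toℕ<n i))) (sym (lookup-index uv))))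

  -- The nodes on the path are mere numbers; equations tie its ends to elements of `Fin n`, and each
  -- arc, being an entry of the edge list, supplies the next such element.
  ↝⇒Reaches : ∀ {u v x y} → x ↝ y → toℕ u ≡ x → toℕ v ≡ y → Reaches G u v
  ↝⇒Reaches {u} ε u≡ v≡ = subst (Reaches G u) (Fin.toℕ-injective (trans u≡ (sym v≡))) ε
  ↝⇒Reaches {u} ((e , e< , refl , refl) ◅ p) u≡ v≡ =
    subst (λ w → Edge G w _) (Fin.toℕ-injective (sym (trans u≡ (tail≡ e<)))) (∈-lookup (fromℕ< e<)) ◅
    ↝⇒Reaches p (sym (head≡ e<)) v≡

  Comparable⇒HasCentre : Comparable n (#edges G) tail head → HasCentre G
  Comparable⇒HasCentre (c , c<n , comparable) = fromℕ< c<n , λ v v≢c →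
    case comparable (Fin.toℕ<n v) (v≢c ∘ Fin.toℕ-injective ∘ (λ eq → trans eq (sym c≡))) of λ where
      (inj₁ p) → inj₁ (↝⇒Reaches p c≡ refl)
      (inj₂ p) → inj₂ (↝⇒Reaches p refl c≡)
    where c≡ = Fin.toℕ-fromℕ< c<n

  HasCentre⇒Comparable : HasCentre G → Comparable n (#edges G) tail head
  HasCentre⇒Comparable (c , comparable) = toℕ c , Fin.toℕ<n c , λ {v} v<n v≢c →
    subst (λ v → toℕ c ↝ v ⊎ v ↝ toℕ c) (Fin.toℕ-fromℕ< v<n)
      (case comparable (fromℕ< v<n) (λ eq → v≢c (trans (sym (Fin.toℕ-fromℕ< v<n)) (cong toℕ eq))) of λ where
        (inj₁ p) → inj₁ (gmap toℕ Edge⇒E p)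
        (inj₂ p) → inj₂ (gmap toℕ Edge⇒E p))

  Searched : State → Set
  Searched s = regs s rN ≡ n × regs s rZero ≡ 0 × ((regs s rResult ≡ 1 × HasCentre G) ⊎ (regs s rResult ≡ 0 × ¬ HasCentre G))

  search-input : Linear (#edges G) searchCost search (input G) Searched
  search-input = linear-map
    (λ { s (n≡ , z≡ , found) → n≡ , z≡ , (case found of λ where
      (inj₁ (r≡1 , comparable)) → inj₁ (r≡1 , Comparable⇒HasCentre comparable)
      (inj₂ (r≡0 , none))       → inj₂ (r≡0 , none ∘ HasCentre⇒Comparable)) })
    (search-correct
      (λ e< → subst (_< n) (sym (tail≡ e<)) (Fin.toℕ<n _)) (λ e< → subst (_< n) (sym (head≡ e<)) (Fin.toℕ<n _))
      (λ comparable → n≤1+#edges G (proj₂ (Comparable⇒HasCentre comparable)))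
      record { n≡ = refl ; m≡ = refl ; z≡ = refl ; res≡ = refl ; min≡ = λ _ → refl ; max≡ = λ _ → refl }
      record { src≡ = λ _ → refl ; tgt≡ = λ _ → refl })

-- For n = 1 the radius is 0, whose code is 1, the value of rN already.
reportCentre reportRadius : Program
reportCentre = rN := reg rResult
reportRadius =
  if rResult ≐ rZero then rN := const 0
  else (rA := const 1 ︔ (if rN ≐ rA then skip else (rN := inc rN)))

report : ∀ {n} (G : Digraph n) p (Q : ℕ → Set) → (∀ s → Searched G s → WP p s (Q ∘ output)) →
         ∃[ s ] ∃[ t ] (⟨ search ︔ p , input G ⟩⇓ s ∣ t × t ≤ (searchCost + cost p) * suc (#edges G) × Q (output s))
report G p Q wp = Linear.runs (linear-seq (search-input G) λ s r → linear-wp p (wp s r))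

decision : ∀ {n} (G : Digraph n) s → Searched G s → WP reportCentre s (Decides HasCentre G ∘ output)
decision G s (_ , _ , found) = found

approximation : ∀ {n} (G : Digraph n) s → Searched G s →
                WP reportRadius s (ApproximatesMinRadius #nodes G ∘ output)
approximation {n} G s (n≡ , z≡ , inj₂ (r≡0 , none)) =
  (λ _ → no-centre-approximation G none) , (λ t → contradiction (trans r≡0 (sym z≡)) (≡ᵇ-false t))
approximation {n} G s (n≡ , z≡ , inj₁ (r≡1 , centre)) =
  (λ t → contradiction (trans (sym r≡1) (trans (≡ᵇ-true t) z≡)) λ ()) ,
  (λ _ →
    (λ t → singleton (trans (sym n≡) (≡ᵇ-true t)) centre (≡ᵇ-true t)) ,
    (λ t → subst (ApproximatesMinRadius #nodes G ∘ suc) (sym n≡)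
      (centre-approximation G (λ n≡1 → ≡ᵇ-false t (trans n≡ n≡1)) centre)))
  where
  singleton : n ≡ 1 → HasCentre G → ∀ {k} → k ≡ 1 → ApproximatesMinRadius #nodes G k
  singleton refl centre refl = singleton-approximation G centre

proposition1 :
    (∃[ p ] SolvesInLinearTime p (Decides HasCentre))
    × (∃[ p ] SolvesInLinearTime p (ApproximatesMinRadius #nodes))
proposition1 =
  ((search ︔ reportCentre) , searchCost + cost reportCentre , λ G → report G reportCentre (Decides HasCentre G) (decision G)) ,
  ((search ︔ reportRadius) , searchCost + cost reportRadius , λ G → report G reportRadius (ApproximatesMinRadius #nodes G) (approximation G))
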